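{- Let $N, M\geq 2$ be integers and let $c,k$ be real numbers. Let $X$ be an $N\times N$ Hermitian complex Hadamard matrix and let $Y$ be a signature $(c,N)$-matrix such that $$cX = kN I_N + XY + YX$$ (that is, $(X,Y)$ is an ETF-amicable pair of $N\times N$ matrices with constants $c$ and $k$). Let $S$ be a signature $(k,M)$-matrix. Then $$B = S\otimes X + I_M\otimes Y$$ is a signature $(c,MN)$-matrix.
   Context: A complex Hadamard matrix of order $N$ is an $N\times N$ complex matrix $H$ with all entries of absolute value $1$ and $HH^*=NI_N$. A signature $(c,N)$-matrix is an $N\times N$ complex matrix $S$ such that $S=S^*$, all diagonal entries of $S$ are $0$, all off-diagonal entries have absolute value $1$, and $S^2=cS+(N-1)I_N$, where $c=(N-2d)\sqrt{\frac{N-1}{d(N-d)}}$ for some integer $d$ with $1\leq d<N$. (These are exactly the signature matrices of equiangular tight frames of $N$ vectors in $\mathbb{C}^d$.) $\otimes$ denotes the Kronecker product and $I_N$ the identity matrix of order $N$. -}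

module Defs where

open import Level using (Level; suc; _⊔_)
open import Algebra.Bundles using (RawRing)
open import Algebra.Core using (Op₁; Op₂)
open import Algebra.Structures using (IsCommutativeRing)
import Algebra.Definitions.RawMonoid as RawMonoidDefinitions
open import Data.Fin.Base using (Fin; quotient; remainder)
open import Data.Fin.Properties using (_≟_)
import Data.Nat.Base as ℕ
open import Data.Nat.Base using (ℕ)
open import Data.Product.Base using (_×_; ∃; ∃-syntax)
open import Relation.Binary.Core using (Rel)
open import Relation.Binary.Definitions using (_Respects_)
open import Relation.Binary.PropositionalEquality.Core using (_≢_)
open import Relation.Binary.Structures using (IsStrictTotalOrder)
open import Relation.Nullary.Decidable.Core using (does)
open import Relation.Nullary.Negation.Core using (¬_)
open import Data.Bool.Base using (if_then_else_)
open import Relation.Unary using (Pred)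

-- The real numbers, given by the classical axioms that characterise them up to
-- isomorphism: a Dedekind-complete totally ordered field.  `_⁻¹` is total; its
-- value at zero is left unspecified.
record CompleteOrderedField (a ℓ : Level) : Set (suc (a ⊔ ℓ)) where
  infix  9 _⁻¹
  infix  8 -_
  infixl 7 _*_ _/_
  infixl 6 _+_ _-_
  infix  4 _≈_ _<_ _≤_ _IsSqrt_
  field
    Carrier            : Set a
    _≈_                : Rel Carrier ℓ
    _<_                : Rel Carrier ℓ
    _+_                : Op₂ Carrier
    _*_                : Op₂ Carrier
    -_                 : Op₁ Carrier
    _⁻¹                : Op₁ Carrier
    0#                 : Carrier
    1#                 : Carrier
    isCommutativeRing  : IsCommutativeRing _≈_ _+_ _*_ -_ 0# 1#
    ⁻¹-cong            : ∀ {x y} → x ≈ y → x ⁻¹ ≈ y ⁻¹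
    ⁻¹-inverseʳ        : ∀ x → ¬ (x ≈ 0#) → x * x ⁻¹ ≈ 1#
    isStrictTotalOrder : IsStrictTotalOrder _≈_ _<_
    0<1                : 0# < 1#
    +-monoˡ-<          : ∀ z {x y} → x < y → x + z < y + z
    *-pos              : ∀ {x y} → 0# < x → 0# < y → 0# < x * y

  _≤_ : Rel Carrier ℓ
  x ≤ y = ¬ (y < x)

  IsUpperBound : Pred Carrier ℓ → Carrier → Set (a ⊔ ℓ)
  IsUpperBound P u = ∀ x → P x → x ≤ u

  IsSupremum : Pred Carrier ℓ → Carrier → Set (a ⊔ ℓ)
  IsSupremum P s = IsUpperBound P s × (∀ u → IsUpperBound P u → s ≤ u)

  field
    complete : ∀ (P : Pred Carrier ℓ) → P Respects _≈_ →
               ∃ P → ∃ (IsUpperBound P) → ∃ (IsSupremum P)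

  _-_ : Op₂ Carrier
  x - y = x + - y

  _/_ : Op₂ Carrier
  x / y = x * y ⁻¹

  rawRing : RawRing a ℓ
  rawRing = record
    { Carrier = Carrier ; _≈_ = _≈_ ; _+_ = _+_ ; _*_ = _*_
    ; -_ = -_ ; 0# = 0# ; 1# = 1# }

  fromℕ : ℕ → Carrier
  fromℕ n = n ×# 1#
    where open RawMonoidDefinitions (RawRing.+-rawMonoid rawRing) renaming (_×_ to _×#_)

  -- `s IsSqrt x` says s = √x.
  _IsSqrt_ : Rel Carrier ℓ
  s IsSqrt x = 0# ≤ s × s * s ≈ x

module ComplexMatrices {a ℓ} (ℝ : CompleteOrderedField a ℓ) where

  private module ℝ = CompleteOrderedField ℝ

  record ℂ : Set a where
    constructor _+i_
    field
      re im : ℝ.Carrier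
  open ℂ public

  ℂ-rawRing : RawRing a ℓ
  ℂ-rawRing = record
    { Carrier = ℂ
    ; _≈_     = λ z w → (re z ℝ.≈ re w) × (im z ℝ.≈ im w)
    ; _+_     = λ z w → (re z ℝ.+ re w) +i (im z ℝ.+ im w)
    ; _*_     = λ z w → (re z ℝ.* re w ℝ.- im z ℝ.* im w)
                     +i (re z ℝ.* im w ℝ.+ im z ℝ.* re w)
    ; -_      = λ z → (ℝ.- re z) +i (ℝ.- im z)
    ; 0#      = ℝ.0# +i ℝ.0#
    ; 1#      = ℝ.1# +i ℝ.0#
    }

  private module ℂ-ring = RawRing ℂ-rawRing
  open RawMonoidDefinitions ℂ-ring.+-rawMonoid using (sum)

  ofReal : ℝ.Carrier → ℂ
  ofReal x = x +i ℝ.0#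

  conj : ℂ → ℂ
  conj z = re z +i (ℝ.- im z)

  -- `r IsModulusOf z` says r = |z| = √(re² + im²).
  _IsModulusOf_ : ℝ.Carrier → ℂ → Set ℓ
  r IsModulusOf z = r ℝ.IsSqrt (re z ℝ.* re z ℝ.+ im z ℝ.* im z)

  Matrix : ℕ → ℕ → Set a
  Matrix m n = Fin m → Fin n → ℂ

  infix  4 _≈ᴹ_ _IsModulusOf_
  infixl 6 _+ᴹ_
  infixl 7 _*ᴹ_ _⊗_
  infixr 8 _·_
  infix  9 _†

  _≈ᴹ_ : ∀ {m n} → Rel (Matrix m n) ℓ
  A ≈ᴹ B = ∀ i j → A i j ℂ-ring.≈ B i j

  _+ᴹ_ : ∀ {m n} → Op₂ (Matrix m n)
  (A +ᴹ B) i j = A i j ℂ-ring.+ B i j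

  _*ᴹ_ : ∀ {m n p} → Matrix m n → Matrix n p → Matrix m p
  (A *ᴹ B) i j = sum (λ k → A i k ℂ-ring.* B k j)

  _·_ : ∀ {m n} → ℝ.Carrier → Matrix m n → Matrix m n
  (x · A) i j = ofReal x ℂ-ring.* A i j

  _† : ∀ {m n} → Matrix m n → Matrix n m
  (A †) i j = conj (A j i)

  I : ∀ n → Matrix n n
  I n i j = if does (i ≟ j) then ℂ-ring.1# else ℂ-ring.0#

  _⊗_ : ∀ {m n p q} → Matrix m n → Matrix p q → Matrix (m ℕ.* p) (n ℕ.* q)
  _⊗_ {m} {n} {p} {q} A B i j =
    A (quotient {m} p i) (quotient {n} q j) ℂ-ring.*
    B (remainder {m} p i) (remainder {n} q j)

  IsHermitian : ∀ {n} → Matrix n n → Set ℓ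
  IsHermitian A = A ≈ᴹ A †

  record IsHadamard (N : ℕ) (H : Matrix N N) : Set ℓ where
    field
      unimodular : ∀ i j → ℝ.1# IsModulusOf H i j
      orthogonal : H *ᴹ H † ≈ᴹ ℝ.fromℕ N · I N

  -- c = (N - 2d) √((N - 1) / (d (N - d)))
  IsSignatureConstant : ℝ.Carrier → ℕ → ℕ → Set (a ⊔ ℓ)
  IsSignatureConstant c N d =
    ∃[ s ] s ℝ.IsSqrt ((n ℝ.- ℝ.1#) ℝ./ (δ ℝ.* (n ℝ.- δ)))
         × c ℝ.≈ (n ℝ.- ℝ.fromℕ 2 ℝ.* δ) ℝ.* s
    where
    n = ℝ.fromℕ N
    δ = ℝ.fromℕ d

  record IsSignature (c : ℝ.Carrier) (N : ℕ) (S : Matrix N N) : Set (a ⊔ ℓ) where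
    field
      hermitian   : IsHermitian S
      diagonal    : ∀ i → S i i ℂ-ring.≈ ℂ-ring.0#
      offDiagonal : ∀ i j → i ≢ j → ℝ.1# IsModulusOf S i j
      quadratic   : S *ᴹ S ≈ᴹ c · S +ᴹ (ℝ.fromℕ N ℝ.- ℝ.1#) · I N
      constant    : ∃[ d ] 1 ℕ.≤ d × d ℕ.< N × IsSignatureConstant c N d

  record IsETFAmicable (c k : ℝ.Carrier) (N : ℕ) (X Y : Matrix N N) : Set (a ⊔ ℓ) where
    field
      X-hermitian : IsHermitian X
      X-hadamard  : IsHadamard N X
      Y-signature : IsSignature c N Y
      amicable    : c · X ≈ᴹ (k ℝ.* ℝ.fromℕ N) · I N +ᴹ X *ᴹ Y +ᴹ Y *ᴹ X

{-# OPTIONS --safe #-}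

-- Put B = S ⊗ X + I ⊗ Y and n = MN.  The mixed-product rule and amicability give
-- B² = S² ⊗ X² + S ⊗ (XY + YX) + I ⊗ Y² = cB + (n − 1)I, whatever the value of c.
-- That c has the form (n − 2d)√((n − 1)/(d(n − d))) is a statement about multiplicities:
-- with e² = c² + 4(n − 1) the eigenvalues of B are (c ± e)/2, the projection onto the
-- eigenspace of (c + e)/2 is ((e − c)I + 2B)/(2e), and its trace n(e − c)/(2e) is a natural
-- number d because idempotent matrices have integral trace.  Hence cn = e(n − 2d), and
-- e/n is the required square root.
module Submission where

open import Defs
open import Algebra.Bundles using (CommutativeRing; RawRing)
open import Algebra.Solver.Ring.AlmostCommutativeRing
  using (fromCommutativeRing; _-Raw-AlmostCommutative⟶_; Induced-equivalence)
open import Data.Bool.Base using (if_then_else_)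
open import Data.Fin.Base as Fin using (Fin; zero; suc; toℕ; fromℕ<; _↑ˡ_; _↑ʳ_; combine; quotient; remainder)
import Data.Fin.Properties as Fin
open import Data.Integer.Base as ℤ using (ℤ; +_; -[1+_]; _⊖_)
import Data.Integer.Properties as ℤ
import Data.Maybe.Base as Maybe
open import Data.Nat.Base as ℕ using (ℕ; zero; suc; z≤n; s≤s)
import Data.Nat.Properties as ℕ
open import Data.Product.Base using (_×_; _,_; proj₁; proj₂; ∃; ∃-syntax)
open import Data.Sum.Base using (_⊎_; inj₁; inj₂)
open import Function.Base using (_∘_; _$_)
open import Level using (Level)
open import Relation.Binary.Consequences using (dec⇒weaklyDec)
open import Relation.Binary.Definitions using (WeaklyDecidable; tri<; tri≈; tri>)
open import Relation.Binary.PropositionalEquality.Core as ≡ using (_≡_; _≢_)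
open import Relation.Binary.Structures using (IsStrictTotalOrder)
open import Relation.Nullary using (¬_; Dec; does; yes; no; contradiction)
open import Relation.Nullary.Decidable using (¬?; decidable-stable)
open import Relation.Unary using (Decidable)
import Algebra.Properties.CommutativeSemigroup
import Algebra.Properties.Ring
import Algebra.Properties.Semiring.Mult
import Algebra.Properties.Semiring.Mult.TCOptimised
import Algebra.Properties.Semiring.Sum
import Algebra.Solver.Ring
import Relation.Binary.Reasoning.Setoid

-- The arithmetic clause of a signature matrix is the obstacle: the integer d has to be extracted
-- from B itself. This is done without eigenvectors or diagonalisation. The projection is a
-- polynomial in B, so its idempotence amounts to two scalar equations, and the zero diagonal of B
-- gives its trace at sight. Integrality of the trace is proved by elimination: each pivot splits
-- off a rank-one summand of trace one, so the trace counts pivots. Choosing a pivot requires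
-- deciding whether a complex number is zero, which trichotomy of the real order provides.
-- Completeness of the reals enters only to extract e from e². Counting pivots bounds d between 0
-- and n. The extremes are excluded by the identity d(n - d)e² = (n - 1)n², whose right side is
-- positive. Taking e positive makes e/n the nonnegative root whatever the sign of c, which is
-- carried by n - 2d.

-- Normalisation of ring expressions with integer coefficients.

module IntegerCoefficientSolver {a ℓ} (R : CommutativeRing a ℓ) where
  open CommutativeRing R hiding (zero)
  open Algebra.Properties.Ring ring
  open Algebra.Properties.Semiring.Mult.TCOptimised semiring
    renaming (_×_ to _×#_)
  open Relation.Binary.Reasoning.Setoid setoid

  private
    -- With the optimised multiple, 1 and 2 evaluate to the literal `1#` and `1# + 1#`, the form in
    -- which later identities write their constants.
    ⟦_⟧ : ℤ → Carrier
    ⟦ + n ⟧      = n ×# 1#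
    ⟦ -[1+ n ] ⟧ = - (suc n ×# 1#)

    -‿homo : ∀ i → ⟦ ℤ.- i ⟧ ≈ - ⟦ i ⟧
    -‿homo (+ zero)   = sym -0#≈0#
    -‿homo (+ suc n)  = refl
    -‿homo (-[1+ n ]) = sym (-‿involutive _)

    ×-suc : ∀ n → suc n ×# 1# ≈ 1# + n ×# 1#
    ×-suc n = ×-homo-+ 1# 1 n

    cancel-1 : ∀ x y → x - y ≈ (1# + x) - (1# + y)
    cancel-1 x y = sym $ begin
      (1# + x) - (1# + y)       ≈⟨ +-cong (+-comm 1# x) (sym (-‿+-comm 1# y)) ⟩
      (x + 1#) + (- 1# - y)     ≈⟨ +-assoc x 1# _ ⟩
      x + (1# + (- 1# - y))     ≈⟨ +-congˡ (+-assoc 1# (- 1#) (- y)) ⟨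
      x + ((1# - 1#) - y)       ≈⟨ +-congˡ (+-congʳ (-‿inverseʳ 1#)) ⟩
      x + (0# - y)              ≈⟨ +-congˡ (+-identityˡ (- y)) ⟩
      x - y                     ∎

    ⊖-homo : ∀ m n → ⟦ m ⊖ n ⟧ ≈ m ×# 1# - n ×# 1#
    ⊖-homo zero zero = sym (-‿inverseʳ 0#)
    ⊖-homo zero (suc n) = sym (+-identityˡ _)
    ⊖-homo (suc m) zero = sym (trans (+-congˡ -0#≈0#) (+-identityʳ _))
    ⊖-homo (suc m) (suc n) = begin
      ⟦ suc m ⊖ suc n ⟧                   ≡⟨ ≡.cong ⟦_⟧ (ℤ.[1+m]⊖[1+n]≡m⊖n m n) ⟩
      ⟦ m ⊖ n ⟧                           ≈⟨ ⊖-homo m n ⟩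
      m ×# 1# - n ×# 1#                   ≈⟨ cancel-1 _ _ ⟩
      (1# + m ×# 1#) - (1# + n ×# 1#)     ≈⟨ +-cong (×-suc m) (-‿cong (×-suc n)) ⟨
      suc m ×# 1# - suc n ×# 1#           ∎

    +-homo : ∀ i j → ⟦ i ℤ.+ j ⟧ ≈ ⟦ i ⟧ + ⟦ j ⟧
    +-homo (+ m)      (+ n)      = ×-homo-+ 1# m n
    +-homo (+ m)      (-[1+ n ]) = ⊖-homo m (suc n)
    +-homo (-[1+ m ]) (+ n)      = trans (⊖-homo n (suc m)) (+-comm _ _)
    +-homo (-[1+ m ]) (-[1+ n ]) = begin
      - (suc (suc (m ℕ.+ n)) ×# 1#)       ≡⟨ ≡.cong (λ k → - (suc k ×# 1#)) (ℕ.+-suc m n) ⟨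
      - ((suc m ℕ.+ suc n) ×# 1#)         ≈⟨ -‿cong (×-homo-+ 1# (suc m) (suc n)) ⟩
      - (suc m ×# 1# + suc n ×# 1#)       ≈⟨ -‿+-comm _ _ ⟨
      - (suc m ×# 1#) - (suc n ×# 1#)     ∎

    *-homoʳ : ∀ m j → ⟦ + m ℤ.* j ⟧ ≈ m ×# 1# * ⟦ j ⟧
    *-homoʳ m (+ n) = begin
      ⟦ + m ℤ.* + n ⟧                 ≡⟨ ≡.cong ⟦_⟧ (ℤ.pos-* m n) ⟨
      (m ℕ.* n) ×# 1#                 ≈⟨ ×1-homo-* m n ⟩
      m ×# 1# * n ×# 1#               ∎
    *-homoʳ m (-[1+ n ]) = begin
      ⟦ + m ℤ.* -[1+ n ] ⟧            ≡⟨ ≡.cong ⟦_⟧ (ℤ.neg-distribʳ-* (+ m) (+ suc n)) ⟨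
      ⟦ ℤ.- (+ m ℤ.* + suc n) ⟧       ≈⟨ -‿homo (+ m ℤ.* + suc n) ⟩
      - ⟦ + m ℤ.* + suc n ⟧           ≈⟨ -‿cong (*-homoʳ m (+ suc n)) ⟩
      - (m ×# 1# * suc n ×# 1#)       ≈⟨ -‿distribʳ-* _ _ ⟩
      m ×# 1# * - (suc n ×# 1#)       ∎

    *-homo : ∀ i j → ⟦ i ℤ.* j ⟧ ≈ ⟦ i ⟧ * ⟦ j ⟧
    *-homo (+ m) j = *-homoʳ m j
    *-homo (-[1+ m ]) j = begin
      ⟦ -[1+ m ] ℤ.* j ⟧              ≡⟨ ≡.cong ⟦_⟧ (ℤ.neg-distribˡ-* (+ suc m) j) ⟨
      ⟦ ℤ.- (+ suc m ℤ.* j) ⟧         ≈⟨ -‿homo (+ suc m ℤ.* j) ⟩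
      - ⟦ + suc m ℤ.* j ⟧             ≈⟨ -‿cong (*-homoʳ (suc m) j) ⟩
      - (suc m ×# 1# * ⟦ j ⟧)         ≈⟨ -‿distribˡ-* _ _ ⟩
      - (suc m ×# 1#) * ⟦ j ⟧         ∎

    homomorphism : ℤ.+-*-rawRing -Raw-AlmostCommutative⟶ fromCommutativeRing R
    homomorphism = record
      { ⟦_⟧ = ⟦_⟧ ; +-homo = +-homo ; *-homo = *-homo ; -‿homo = -‿homo
      ; 0-homo = refl ; 1-homo = refl }

    weaklyDec : WeaklyDecidable (Induced-equivalence homomorphism)
    weaklyDec i j = Maybe.map (λ i≡j → reflexive (≡.cong ⟦_⟧ i≡j)) (dec⇒weaklyDec ℤ._≟_ i j)

  open Algebra.Solver.Ring ℤ.+-*-rawRing (fromCommutativeRing R) homomorphism weaklyDec public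
    using (solve; _:=_; _:+_; _:*_; _:-_; :-_; con)

-- Finite sums, and sums indexed by pairs.

module CommutativeRingSums {a ℓ} (R : CommutativeRing a ℓ) where
  open CommutativeRing R hiding (zero)
  open Algebra.Properties.Semiring.Sum semiring
  open IntegerCoefficientSolver R
  open Relation.Binary.Reasoning.Setoid setoid

  -- This is one entry of a product of two matrices, each a combination of two others. It serves
  -- both the elimination step for idempotents and the square of αB + βI.
  ∑-bilinear : ∀ {n} (α β γ δ : Carrier) (f g u v : Fin n → Carrier) →
               ∑[ k < n ] ((α * f k + β * g k) * (γ * u k + δ * v k)) ≈
               α * γ * ∑[ k < n ] (f k * u k) + α * δ * ∑[ k < n ] (f k * v k) +
               β * γ * ∑[ k < n ] (g k * u k) + β * δ * ∑[ k < n ] (g k * v k)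
  ∑-bilinear {zero} α β γ δ _ _ _ _ =
    solve 4 (λ α β γ δ → con (+ 0) := α :* γ :* con (+ 0) :+ α :* δ :* con (+ 0)
                                     :+ β :* γ :* con (+ 0) :+ β :* δ :* con (+ 0))
      refl α β γ δ
  ∑-bilinear {suc n} α β γ δ f g u v = trans
    (+-congˡ (∑-bilinear α β γ δ (f ∘ suc) (g ∘ suc) (u ∘ suc) (v ∘ suc)))
    (solve 12 (λ α β γ δ f g u v fu fv gu gv →
       (α :* f :+ β :* g) :* (γ :* u :+ δ :* v) :+
       (α :* γ :* fu :+ α :* δ :* fv :+ β :* γ :* gu :+ β :* δ :* gv) :=
       α :* γ :* (f :* u :+ fu) :+ α :* δ :* (f :* v :+ fv) :+
       β :* γ :* (g :* u :+ gu) :+ β :* δ :* (g :* v :+ gv))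
      refl α β γ δ (f zero) (g zero) (u zero) (v zero) _ _ _ _)

  ∑-distrib-* : ∀ {n} (f g u v : Fin n → Carrier) →
                ∑[ k < n ] ((f k + g k) * (u k + v k)) ≈
                ∑[ k < n ] (f k * u k) + ∑[ k < n ] (f k * v k) +
                ∑[ k < n ] (g k * u k) + ∑[ k < n ] (g k * v k)
  ∑-distrib-* {n} f g u v = begin
    ∑[ k < n ] ((f k + g k) * (u k + v k))
      ≈⟨ sum-cong-≋ (λ k → solve 4 (λ f g u v → (f :+ g) :* (u :+ v) :=
           (con (+ 1) :* f :+ con (+ 1) :* g) :* (con (+ 1) :* u :+ con (+ 1) :* v))
           refl (f k) (g k) (u k) (v k)) ⟩
    ∑[ k < n ] ((1# * f k + 1# * g k) * (1# * u k + 1# * v k))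
      ≈⟨ ∑-bilinear 1# 1# 1# 1# f g u v ⟩
    1# * 1# * ∑[ k < n ] (f k * u k) + 1# * 1# * ∑[ k < n ] (f k * v k) +
    1# * 1# * ∑[ k < n ] (g k * u k) + 1# * 1# * ∑[ k < n ] (g k * v k)
      ≈⟨ solve 4 (λ x y z w → let 1² = con (+ 1) :* con (+ 1) in
           1² :* x :+ 1² :* y :+ 1² :* z :+ 1² :* w := x :+ y :+ z :+ w)
           refl (∑[ k < n ] (f k * u k)) (∑[ k < n ] (f k * v k))
                (∑[ k < n ] (g k * u k)) (∑[ k < n ] (g k * v k)) ⟩
    ∑[ k < n ] (f k * u k) + ∑[ k < n ] (f k * v k) +
    ∑[ k < n ] (g k * u k) + ∑[ k < n ] (g k * v k) ∎

  ∑-+ : ∀ m {n} (f : Fin (m ℕ.+ n) → Carrier) →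
        sum f ≈ ∑[ i < m ] f (i ↑ˡ n) + ∑[ j < n ] f (m ↑ʳ j)
  ∑-+ zero    f = sym (+-identityˡ _)
  ∑-+ (suc m) f = trans (+-congˡ (∑-+ m (f ∘ suc))) (sym (+-assoc _ _ _))

  -- `suc m * n` unfolds to `n + m * n`, and `combine` sends row `zero` into the left summand and
  -- the other rows into the right one, so splitting the sum peels off one row.
  ∑-combine : ∀ m {n} (f : Fin (m ℕ.* n) → Carrier) →
              sum f ≈ ∑[ i < m ] ∑[ j < n ] f (combine i j)
  ∑-combine zero        f = refl
  ∑-combine (suc m) {n} f = trans (∑-+ n f) (+-congˡ (∑-combine m (f ∘ (n ↑ʳ_))))

  -- An index of a Kronecker product is a pair in disguise; the mixed-product rule comes down to
  -- this factorisation.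
  ∑-quotient-remainder : ∀ m n (f : Fin m → Carrier) (g : Fin n → Carrier) →
    ∑[ k < m ℕ.* n ] (f (quotient {m} n k) * g (remainder {m} n k)) ≈ sum f * sum g
  ∑-quotient-remainder m n f g = begin
    ∑[ k < m ℕ.* n ] (f (quotient n k) * g (remainder {m} n k))
      ≈⟨ ∑-combine m _ ⟩
    ∑[ i < m ] ∑[ j < n ] (f (quotient n (combine i j)) * g (remainder {m} n (combine i j)))
      ≡⟨ sum-cong-≗ (λ i → sum-cong-≗ λ j →
           ≡.cong (λ (p , q) → f p * g q) (Fin.remQuot-combine {m} {n} i j)) ⟩
    ∑[ i < m ] ∑[ j < n ] (f i * g j)
      ≈⟨ sum-cong-≋ (λ i → *-distribˡ-sum (f i) g) ⟨
    ∑[ i < m ] (f i * sum g)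
      ≈⟨ *-distribʳ-sum (sum g) f ⟨
    sum f * sum g ∎

-- Scalar identities behind B² and the projection.

module RingIdentities {a ℓ} (R : CommutativeRing a ℓ) where
  open CommutativeRing R
  open IntegerCoefficientSolver R
  open Relation.Binary.Reasoning.Setoid setoid

  -- One entry of B², with `δ` and `ε` the entries of the two identity matrices. The term k s n ε
  -- coming from S² ⊗ X² is exactly what s(xy + yx) lacks to become c s x; this is why the constant
  -- of S must be `k`. The identity part collects (m - 1)n + (n - 1) = mn - 1.
  signature-block : ∀ c k m n s x y δ ε xy yx → c * x ≈ k * n * ε + xy + yx →
    (k * s + (m - 1#) * δ) * (n * ε) + s * xy + s * yx + δ * (c * y + (n - 1#) * ε) ≈
    c * (s * x + δ * y) + (m * n - 1#) * (δ * ε)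
  signature-block c k m n s x y δ ε xy yx cx≈ = begin
    (k * s + (m - 1#) * δ) * (n * ε) + s * xy + s * yx + δ * (c * y + (n - 1#) * ε)
      ≈⟨ solve 10 (λ c k m n s y δ ε xy yx →
           (k :* s :+ (m :- con (+ 1)) :* δ) :* (n :* ε) :+ s :* xy :+ s :* yx :+ δ :* (c :* y :+ (n :- con (+ 1)) :* ε) :=
           s :* (k :* n :* ε :+ xy :+ yx) :+ c :* (δ :* y) :+ (m :* n :- con (+ 1)) :* (δ :* ε))
           refl c k m n s y δ ε xy yx ⟩
    s * (k * n * ε + xy + yx) + c * (δ * y) + (m * n - 1#) * (δ * ε)
      ≈⟨ +-congʳ (+-congʳ (*-congˡ cx≈)) ⟨
    s * (c * x) + c * (δ * y) + (m * n - 1#) * (δ * ε)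
      ≈⟨ +-congʳ (solve 5 (λ c s x δ y → s :* (c :* x) :+ c :* (δ :* y) := c :* (s :* x :+ δ :* y)) refl c s x δ y) ⟩
    c * (s * x + δ * y) + (m * n - 1#) * (δ * ε) ∎

  -- If B² = cB + mI, comparing coefficients in (αB + βI)² = αB + βI gives α(αc + 2β) = α and α²m +
  -- β² = β. The first hypothesis is the former equation with α divided out.
  idempotent-coefficients : ∀ c m α β b ι → α * c + (β + β) ≈ 1# → α * α * m + β * β ≈ β →
    α * α * (c * b + m * ι) + α * β * b + β * α * b + β * β * ι ≈ α * b + β * ι
  idempotent-coefficients c m α β b ι lin quad = begin
    α * α * (c * b + m * ι) + α * β * b + β * α * b + β * β * ι
      ≈⟨ solve 6 (λ c m α β b ι →
           α :* α :* (c :* b :+ m :* ι) :+ α :* β :* b :+ β :* α :* b :+ β :* β :* ι :=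
           α :* (α :* c :+ (β :+ β)) :* b :+ (α :* α :* m :+ β :* β) :* ι) refl c m α β b ι ⟩
    α * (α * c + (β + β)) * b + (α * α * m + β * β) * ι
      ≈⟨ +-cong (*-congʳ (trans (*-congˡ lin) (*-identityʳ α))) (*-congʳ quad) ⟩
    α * b + β * ι ∎

  -- In the next four lemmas, e is the distance between the two eigenvalues (c ± e)/2 of a matrix B with
  -- B² = cB + mI, so e² = c² + 4m; with h = 1/(2e), the matrix 2hB + h(e − c)I is the
  -- projection onto the eigenspace of (c + e)/2.
  module _ (c e h : Carrier) (2eh≈1 : (1# + 1#) * e * h ≈ 1#) where

    projection-linear : (1# + 1#) * h * c + (h * (e - c) + h * (e - c)) ≈ 1#
    projection-linear = trans
      (solve 3 (λ c e h → con (+ 2) :* h :* c :+ (h :* (e :- c) :+ h :* (e :- c)) := con (+ 2) :* e :* h)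
        refl c e h)
      2eh≈1

    projection-quadratic : ∀ m → e * e ≈ c * c + (1# + 1#) * (1# + 1#) * m →
      (1# + 1#) * h * ((1# + 1#) * h) * m + h * (e - c) * (h * (e - c)) ≈ h * (e - c)
    projection-quadratic m e²≈ = begin
      (1# + 1#) * h * ((1# + 1#) * h) * m + h * (e - c) * (h * (e - c))
        ≈⟨ solve 4 (λ c e h m →
             con (+ 2) :* h :* (con (+ 2) :* h) :* m :+ h :* (e :- c) :* (h :* (e :- c)) :=
             h :* h :* ((c :* c :+ con (+ 2) :* con (+ 2) :* m) :- c :* c :+ (e :- c) :* (e :- c)))
             refl c e h m ⟩
      h * h * ((c * c + (1# + 1#) * (1# + 1#) * m) - c * c + (e - c) * (e - c))
        ≈⟨ *-congˡ (+-congʳ (+-congʳ e²≈)) ⟨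
      h * h * (e * e - c * c + (e - c) * (e - c))
        ≈⟨ solve 3 (λ c e h →
             h :* h :* (e :* e :- c :* c :+ (e :- c) :* (e :- c)) :=
             con (+ 2) :* e :* h :* (h :* (e :- c))) refl c e h ⟩
      (1# + 1#) * e * h * (h * (e - c))
        ≈⟨ trans (*-congʳ 2eh≈1) (*-identityˡ _) ⟩
      h * (e - c) ∎

    gap-multiplicity : ∀ ν d → ν * (h * (e - c)) ≈ d → c * ν ≈ e * (ν - (1# + (1# + 0#)) * d)
    gap-multiplicity ν d νβ≈d = begin
      c * ν
        ≈⟨ solve 3 (λ c e ν → c :* ν := e :* ν :- con (+ 1) :* (ν :* (e :- c))) refl c e ν ⟩
      e * ν - 1# * (ν * (e - c))
        ≈⟨ +-congˡ (-‿cong (*-congʳ 2eh≈1)) ⟨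
      e * ν - (1# + 1#) * e * h * (ν * (e - c))
        ≈⟨ solve 4 (λ c e h ν →
             e :* ν :- con (+ 2) :* e :* h :* (ν :* (e :- c)) :=
             e :* (ν :- (con (+ 1) :+ (con (+ 1) :+ con (+ 0))) :* (ν :* (h :* (e :- c)))))
             refl c e h ν ⟩
      e * (ν - (1# + (1# + 0#)) * (ν * (h * (e - c))))
        ≈⟨ *-congˡ (+-congˡ (-‿cong (*-congˡ νβ≈d))) ⟩
      e * (ν - (1# + (1# + 0#)) * d) ∎

  gap-product : ∀ c e m ν d → e * e ≈ c * c + (1# + 1#) * (1# + 1#) * m →
    c * ν ≈ e * (ν - (1# + (1# + 0#)) * d) →
    (1# + 1#) * (1# + 1#) * (m * (ν * ν)) ≈ (1# + 1#) * (1# + 1#) * (d * (ν - d) * (e * e))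
  gap-product c e m ν d e²≈ cν≈ = begin
    (1# + 1#) * (1# + 1#) * (m * (ν * ν))
      ≈⟨ solve 3 (λ c n m →
           con (+ 2) :* con (+ 2) :* (m :* (n :* n)) :=
           (c :* c :+ con (+ 2) :* con (+ 2) :* m) :* (n :* n) :- (c :* n) :* (c :* n))
           refl c ν m ⟩
    (c * c + (1# + 1#) * (1# + 1#) * m) * (ν * ν) - (c * ν) * (c * ν)
      ≈⟨ +-cong (*-congʳ (sym e²≈)) (-‿cong (*-cong cν≈ cν≈)) ⟩
    e * e * (ν * ν) - e * (ν - (1# + (1# + 0#)) * d) * (e * (ν - (1# + (1# + 0#)) * d))
      ≈⟨ solve 3 (λ e n d → let 2d = (con (+ 1) :+ (con (+ 1) :+ con (+ 0))) :* d in
           e :* e :* (n :* n) :- e :* (n :- 2d) :* (e :* (n :- 2d)) :=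
           con (+ 2) :* con (+ 2) :* (d :* (n :- d) :* (e :* e)))
           refl e ν d ⟩
    (1# + 1#) * (1# + 1#) * (d * (ν - d) * (e * e)) ∎

-- Integrality of the trace of an idempotent matrix.

module IdempotentTrace {a ℓ} (R : CommutativeRing a ℓ)
  (≈0? : Decidable (λ x → CommutativeRing._≈_ R x (CommutativeRing.0# R)))
  (invert : ∀ x → ¬ CommutativeRing._≈_ R x (CommutativeRing.0# R) →
            ∃ λ y → CommutativeRing._≈_ R (CommutativeRing._*_ R x y) (CommutativeRing.1# R))
  where
  open CommutativeRing R hiding (zero)
  open Algebra.Properties.Semiring.Sum semiring
  open Algebra.Properties.Semiring.Mult semiring renaming (_×_ to _×#_)
  open IntegerCoefficientSolver R
  open CommutativeRingSums R
  open Relation.Binary.Reasoning.Setoid setoid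

  IsIdempotent : ∀ {n} → (Fin n → Fin n → Carrier) → Set ℓ
  IsIdempotent {n} P = ∀ a b → ∑[ k < n ] (P a k * P k b) ≈ P a b

  trace : ∀ {n} → (Fin n → Fin n → Carrier) → Carrier
  trace {n} P = ∑[ k < n ] P k k

  -- Wedderburn's rank reduction at a pivot P i j with inverse w: the matrix stays idempotent,
  -- its trace drops by one, row i becomes zero and zero rows stay zero.
  module _ {n} (P : Fin n → Fin n → Carrier) (i j : Fin n) (w : Carrier) where

    deflate : Fin n → Fin n → Carrier
    deflate a b = P a b - P a j * w * P i b

    deflate-idempotent : IsIdempotent P → P i j * w ≈ 1# → IsIdempotent deflate
    deflate-idempotent P²≈P pw≈1 a b = begin
      ∑[ k < n ] (deflate a k * deflate k b)
        -- Each factor becomes a row or column of `P` plus a multiple of the pivot row or column,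
        -- with multipliers independent of `k`.
        ≈⟨ sum-cong-≋ (λ k → solve 7 (λ pak paj w pik pkb pkj pib →
             (pak :- paj :* w :* pik) :* (pkb :- pkj :* w :* pib) :=
             (con (+ 1) :* pak :+ (:- (paj :* w)) :* pik) :*
             (con (+ 1) :* pkb :+ (:- (w :* pib)) :* pkj))
             refl (P a k) (P a j) w (P i k) (P k b) (P k j) (P i b)) ⟩
      ∑[ k < n ] ((1# * P a k + (- (P a j * w)) * P i k) *
                  (1# * P k b + (- (w * P i b)) * P k j))
        ≈⟨ ∑-bilinear 1# (- (P a j * w)) 1# (- (w * P i b))
             (P a) (P i) (λ k → P k b) (λ k → P k j) ⟩
      _ ≈⟨ +-cong (+-cong (+-cong (*-congˡ (P²≈P a b)) (*-congˡ (P²≈P a j)))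
                          (*-congˡ (P²≈P i b))) (*-congˡ (P²≈P i j)) ⟩
      1# * 1# * P a b + 1# * (- (w * P i b)) * P a j +
      (- (P a j * w)) * 1# * P i b + (- (P a j * w)) * (- (w * P i b)) * P i j
        -- The two cross terms subtract the rank-one term twice; the last product, through
        -- `P i j * w`, adds it back once.
        ≈⟨ solve 5 (λ pab paj pib pij w →
             con (+ 1) :* con (+ 1) :* pab :+ con (+ 1) :* (:- (w :* pib)) :* paj :+
             (:- (paj :* w)) :* con (+ 1) :* pib :+ (:- (paj :* w)) :* (:- (w :* pib)) :* pij :=
             pab :- (paj :* w :* pib) :* (con (+ 2) :- pij :* w))
             refl (P a b) (P a j) (P i b) (P i j) w ⟩
      P a b - P a j * w * P i b * ((1# + 1#) - P i j * w)
        ≈⟨ +-congˡ (-‿cong (*-congˡ (+-congˡ (-‿cong pw≈1)))) ⟩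
      P a b - P a j * w * P i b * ((1# + 1#) - 1#)
        ≈⟨ solve 2 (λ x y → x :- y :* (con (+ 2) :- con (+ 1)) := x :- y) refl _ _ ⟩
      deflate a b ∎

    trace-deflate : IsIdempotent P → P i j * w ≈ 1# → trace P ≈ 1# + trace deflate
    trace-deflate P²≈P pw≈1 = begin
      trace P
        ≈⟨ sum-cong-≋ (λ k → solve 4 (λ pkk pkj w pik →
             pkk := w :* (pik :* pkj) :+ (pkk :- pkj :* w :* pik))
             refl (P k k) (P k j) w (P i k)) ⟩
      ∑[ k < n ] (w * (P i k * P k j) + deflate k k)
        ≈⟨ ∑-distrib-+ (λ k → w * (P i k * P k j)) (λ k → deflate k k) ⟩
      ∑[ k < n ] (w * (P i k * P k j)) + trace deflate
        ≈⟨ +-congʳ (*-distribˡ-sum w (λ k → P i k * P k j)) ⟨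
      w * ∑[ k < n ] (P i k * P k j) + trace deflate
        -- The removed summand has trace `w` times an entry of P², and idempotence turns that entry
        -- into the pivot.
        ≈⟨ +-congʳ (trans (*-congˡ (P²≈P i j)) (trans (*-comm _ _) pw≈1)) ⟩
      1# + trace deflate ∎

    deflate-pivot-row : P i j * w ≈ 1# → ∀ b → deflate i b ≈ 0#
    deflate-pivot-row pw≈1 b = begin
      P i b - P i j * w * P i b  ≈⟨ +-congˡ (-‿cong (*-congʳ pw≈1)) ⟩
      P i b - 1# * P i b         ≈⟨ solve 1 (λ x → x :- con (+ 1) :* x := con (+ 0)) refl _ ⟩
      0#                         ∎

    deflate-zero-row : ∀ a → (∀ b → P a b ≈ 0#) → ∀ b → deflate a b ≈ 0#
    deflate-zero-row a Pa≈0 b = begin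
      P a b - P a j * w * P i b  ≈⟨ +-cong (Pa≈0 b) (-‿cong (*-congʳ (*-congʳ (Pa≈0 j)))) ⟩
      0# - 0# * w * P i b        ≈⟨ solve 2 (λ w x → con (+ 0) :- con (+ 0) :* w :* x := con (+ 0)) refl w _ ⟩
      0#                         ∎

  extend-zero-rows : ∀ {n k} (P : Fin n → Fin n → Carrier) (k<n : k ℕ.< n) →
                     (∀ i → k ℕ.< toℕ i → ∀ j → P i j ≈ 0#) → (∀ j → P (fromℕ< k<n) j ≈ 0#) →
                     ∀ i → k ℕ.≤ toℕ i → ∀ j → P i j ≈ 0#
  extend-zero-rows P k<n below row i k≤i with ℕ.m≤n⇒m<n∨m≡n k≤i
  ... | inj₁ k<i = below i k<i
  ... | inj₂ k≡i = ≡.subst (λ i → ∀ j → P i j ≈ 0#)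
                     (Fin.toℕ-injective (≡.trans (Fin.toℕ-fromℕ< k<n) k≡i)) row

  -- Induction on the number of leading rows that may be nonzero. If the last of them vanishes, it
  -- is dropped; otherwise a nonzero entry of it serves as pivot, and deflation clears the row at
  -- the cost of one unit of trace. Hence `r` counts the pivots.
  trace-of-rows : ∀ {n} k → k ℕ.≤ n → (P : Fin n → Fin n → Carrier) → IsIdempotent P →
                  (∀ i → k ℕ.≤ toℕ i → ∀ j → P i j ≈ 0#) →
                  ∃[ r ] r ℕ.≤ k × trace P ≈ r ×# 1#
  trace-of-rows {n} zero _ P _ P≈0 = zero , z≤n ,
    trans (sum-cong-≋ (λ i → P≈0 i z≤n i)) (sum-replicate-zero n)
  trace-of-rows (suc k) k<n P P²≈P P≈0 with Fin.any? (λ j → ¬? (≈0? (P (fromℕ< k<n) j)))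
  ... | no row≈0 =
    let r , r≤k , eq = trace-of-rows k (ℕ.<⇒≤ k<n) P P²≈P
                         (extend-zero-rows P k<n P≈0 λ j →
                            decidable-stable (≈0? _) (λ pj≉0 → row≈0 (j , pj≉0)))
    in r , ℕ.m≤n⇒m≤1+n r≤k , eq
  ... | yes (j , pj≉0) =
    let i = fromℕ< k<n
        w , pw≈1 = invert (P i j) pj≉0
        r , r≤k , eq = trace-of-rows k (ℕ.<⇒≤ k<n)
                         (deflate P i j w) (deflate-idempotent P i j w P²≈P pw≈1)
                         (extend-zero-rows _ k<n
                            (λ a k<a → deflate-zero-row P i j w a (P≈0 a k<a))
                            (deflate-pivot-row P i j w pw≈1))
    in suc r , s≤s r≤k , trans (trace-deflate P i j w P²≈P pw≈1) (+-congˡ eq)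

  idempotent-trace : ∀ {n} (P : Fin n → Fin n → Carrier) → IsIdempotent P →
                     ∃[ r ] r ℕ.≤ n × trace P ≈ r ×# 1#
  idempotent-trace {n} P P²≈P = trace-of-rows n ℕ.≤-refl P P²≈P
    (λ i n≤i → contradiction (Fin.toℕ<n i) (ℕ.≤⇒≯ n≤i))

-- Order, inverses and square roots in the real numbers.

module OrderedFieldProperties {a ℓ} (ℝ : CompleteOrderedField a ℓ) where
  open CompleteOrderedField ℝ

  commutativeRing : CommutativeRing a ℓ
  commutativeRing = record { isCommutativeRing = isCommutativeRing }

  open CommutativeRing commutativeRing
    using (refl; sym; trans; setoid; semiring; +-cong; +-congˡ; +-congʳ; *-cong; *-congˡ; *-congʳ;
           -‿cong; +-identityˡ; *-identityˡ; *-identityʳ; zeroˡ; zeroʳ)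
  open IsStrictTotalOrder isStrictTotalOrder
    using (compare; _≟_; irrefl; <-resp-≈) renaming (trans to <-trans) public
  open Algebra.Properties.Semiring.Mult semiring using (×-homo-+; ×1-homo-*)
  open IntegerCoefficientSolver commutativeRing
  open RingIdentities commutativeRing
  open Relation.Binary.Reasoning.Setoid setoid

  <-cong : ∀ {x x′ y y′} → x ≈ x′ → y ≈ y′ → x < y → x′ < y′
  <-cong x≈x′ y≈y′ x<y = proj₂ <-resp-≈ x≈x′ (proj₁ <-resp-≈ y≈y′ x<y)

  x<y⇒0<y-x : ∀ {x y} → x < y → 0# < y - x
  x<y⇒0<y-x {x} x<y =
    <-cong (solve 1 (λ x → x :- x := con (+ 0)) refl x) refl (+-monoˡ-< (- x) x<y)

  0<y-x⇒x<y : ∀ {x y} → 0# < y - x → x < y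
  0<y-x⇒x<y {x} {y} 0<y-x =
    <-cong (+-identityˡ x) (solve 2 (λ x y → y :- x :+ x := y) refl x y) (+-monoˡ-< x 0<y-x)

  x<0⇒0<-x : ∀ {x} → x < 0# → 0# < - x
  x<0⇒0<-x {x} x<0 = <-cong refl (+-identityˡ (- x)) (x<y⇒0<y-x x<0)

  0≤x⇒0<x∨x≈0 : ∀ {x} → 0# ≤ x → 0# < x ⊎ x ≈ 0#
  0≤x⇒0<x∨x≈0 {x} 0≤x with compare 0# x
  ... | tri< 0<x _ _ = inj₁ 0<x
  ... | tri≈ _ 0≈x _ = inj₂ (sym 0≈x)
  ... | tri> _ _ x<0 = contradiction x<0 0≤x

  <⇒≤ : ∀ {x y} → x < y → x ≤ y
  <⇒≤ x<y y<x = irrefl refl (<-trans x<y y<x)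

  ≈⇒≤ : ∀ {x y} → x ≈ y → x ≤ y
  ≈⇒≤ x≈y y<x = irrefl (sym x≈y) y<x

  0<x⇒x≉0 : ∀ {x} → 0# < x → ¬ x ≈ 0#
  0<x⇒x≉0 0<x x≈0 = irrefl (sym x≈0) 0<x

  +-pos : ∀ {x y} → 0# < x → 0# < y → 0# < x + y
  +-pos {x} {y} 0<x 0<y = <-trans 0<y (<-cong (+-identityˡ y) refl (+-monoˡ-< y 0<x))

  +-nonneg-pos : ∀ {x y} → 0# ≤ x → 0# < y → 0# < x + y
  +-nonneg-pos {x} {y} 0≤x 0<y with 0≤x⇒0<x∨x≈0 0≤x
  ... | inj₁ 0<x = +-pos 0<x 0<y
  ... | inj₂ x≈0 = <-cong refl (sym (trans (+-congʳ x≈0) (+-identityˡ y))) 0<y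

  x≉0⇒0<x*x : ∀ {x} → ¬ x ≈ 0# → 0# < x * x
  x≉0⇒0<x*x {x} x≉0 with compare 0# x
  ... | tri< 0<x _ _ = *-pos 0<x 0<x
  ... | tri≈ _ 0≈x _ = contradiction (sym 0≈x) x≉0
  ... | tri> _ _ x<0 = <-cong refl (solve 1 (λ x → :- x :* :- x := x :* x) refl x)
                         (*-pos (x<0⇒0<-x x<0) (x<0⇒0<-x x<0))

  0≤x*x : ∀ x → 0# ≤ x * x
  0≤x*x x with x ≟ 0#
  ... | yes x≈0 = ≈⇒≤ (sym (trans (*-congʳ x≈0) (zeroˡ x)))
  ... | no  x≉0 = <⇒≤ (x≉0⇒0<x*x x≉0)

  x*x+y*y≈0⇒y≈0 : ∀ x y → x * x + y * y ≈ 0# → y ≈ 0#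
  x*x+y*y≈0⇒y≈0 x y sum≈0 with y ≟ 0#
  ... | yes y≈0 = y≈0
  ... | no  y≉0 = contradiction sum≈0 (0<x⇒x≉0 (+-nonneg-pos (0≤x*x x) (x≉0⇒0<x*x y≉0)))

  0≤x∧0<x*x⇒0<x : ∀ {x} → 0# ≤ x → 0# < x * x → 0# < x
  0≤x∧0<x*x⇒0<x {x} 0≤x 0<x² with 0≤x⇒0<x∨x≈0 0≤x
  ... | inj₁ 0<x = 0<x
  ... | inj₂ x≈0 = contradiction (trans (*-congʳ x≈0) (zeroˡ x)) (0<x⇒x≉0 0<x²)

  *-mono-square-< : ∀ {x y} → 0# ≤ x → x < y → x * x < y * y
  *-mono-square-< {x} {y} 0≤x x<y = 0<y-x⇒x<y (<-cong refl
    -- The factor x + y is rewritten with y = x + (y - x), so that its positivity follows from the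
    -- signs of x and y - x.
    (solve 2 (λ x y → (y :- x) :* (x :+ (x :+ (y :- x))) := y :* y :- x :* x) refl x y)
    (*-pos 0<d (+-nonneg-pos 0≤x (+-nonneg-pos 0≤x 0<d))))
    where 0<d = x<y⇒0<y-x x<y

  *-cancelˡ : ∀ {x y z} → ¬ x ≈ 0# → x * y ≈ x * z → y ≈ z
  *-cancelˡ {x} {y} {z} x≉0 xy≈xz = begin
    y                ≈⟨ x⁻¹xy≈y y ⟨
    x ⁻¹ * (x * y)   ≈⟨ *-congˡ xy≈xz ⟩
    x ⁻¹ * (x * z)   ≈⟨ x⁻¹xy≈y z ⟩
    z                ∎
    where
    x⁻¹xy≈y : ∀ y → x ⁻¹ * (x * y) ≈ y
    x⁻¹xy≈y y = begin
      x ⁻¹ * (x * y)   ≈⟨ solve 3 (λ x w y → w :* (x :* y) := y :* (x :* w)) refl x (x ⁻¹) y ⟩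
      y * (x * x ⁻¹)   ≈⟨ *-congˡ (⁻¹-inverseʳ x x≉0) ⟩
      y * 1#           ≈⟨ *-identityʳ y ⟩
      y                ∎

  ⁻¹-pos : ∀ {x} → 0# < x → 0# < x ⁻¹
  ⁻¹-pos {x} 0<x with compare 0# (x ⁻¹)
  ... | tri< 0<w _ _ = 0<w
  ... | tri≈ _ 0≈w _ = contradiction (begin
          1#       ≈⟨ ⁻¹-inverseʳ x (0<x⇒x≉0 0<x) ⟨
          x * x ⁻¹ ≈⟨ *-congˡ 0≈w ⟨
          x * 0#   ≈⟨ zeroʳ x ⟩
          0#       ∎) (0<x⇒x≉0 0<1)
  -- A negative inverse would make x · (-x⁻¹) + 1 positive, yet it equals zero.
  ... | tri> _ _ w<0 = contradiction (+-pos (*-pos 0<x (x<0⇒0<-x w<0)) 0<1) (irrefl (sym (begin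
          x * - x ⁻¹ + 1#  ≈⟨ solve 2 (λ x w → x :* :- w :+ con (+ 1) := con (+ 1) :- x :* w) refl x (x ⁻¹) ⟩
          1# - x * x ⁻¹    ≈⟨ +-congˡ (-‿cong (⁻¹-inverseʳ x (0<x⇒x≉0 0<x))) ⟩
          1# - 1#          ≈⟨ solve 0 (con (+ 1) :- con (+ 1) := con (+ 0)) refl ⟩
          0#               ∎)))

  -- Dedekind's map s ↦ q = s + (x − s²)/(s + b) moves s towards √x without overshooting,
  -- because q² − x = (s² − x)(b² − x)/(s + b)² and b² > x.  So the supremum s of
  -- { y | y² < x } can be neither too small nor too large.
  module _ {x} (0<x : 0# < x) where
    private
      -- A number whose square visibly exceeds x, since b² - x = 1 + x + x²; it serves both as an
      -- upper bound and in the denominator s + b.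
      b = 1# + x

      0<b²-x : 0# < b * b - x
      0<b²-x = <-cong refl
        (solve 1 (λ x → con (+ 1) :+ (x :+ x :* x) := (con (+ 1) :+ x) :* (con (+ 1) :+ x) :- x) refl x)
        (+-pos 0<1 (+-pos 0<x (*-pos 0<x 0<x)))

      Below : Carrier → Set ℓ
      Below y = y * y < x

      b-upper : IsUpperBound Below b
      b-upper y y²<x b<y = irrefl refl (<-trans
        (<-trans (0<y-x⇒x<y 0<b²-x) (*-mono-square-< (<⇒≤ (+-pos 0<1 0<x)) b<y)) y²<x)

      0-below : Below 0#
      0-below = <-cong (sym (zeroˡ 0#)) refl 0<x

      module Dedekind {s} (0≤s : 0# ≤ s) where
        0<s+b : 0# < s + b
        0<s+b = +-nonneg-pos 0≤s (+-pos 0<1 0<x)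

        w = (s + b) ⁻¹

        0<w : 0# < w
        0<w = ⁻¹-pos 0<s+b

        sw+bw≈1 : s * w + b * w ≈ 1#
        sw+bw≈1 = trans (solve 3 (λ s b w → s :* w :+ b :* w := (s :+ b) :* w) refl s b w)
                    (⁻¹-inverseʳ (s + b) (0<x⇒x≉0 0<s+b))

        q = s + (x - s * s) * w

        q²-x : q * q - x ≈ (s * s - x) * ((b * b - x) * (w * w))
        q²-x = begin
          q * q - x
            -- With t = s² - x one has q = s - tw, so q² - x = t(1 - 2sw + tw²), and the bracket
            -- equals (1 - sw)² - xw².
            ≈⟨ solve 3 (λ x s w → let q = s :+ (x :- s :* s) :* w in
                 q :* q :- x := (s :* s :- x) :* ((con (+ 1) :- s :* w) :* (con (+ 1) :- s :* w) :- x :* (w :* w)))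
                 refl x s w ⟩
          (s * s - x) * ((1# - s * w) * (1# - s * w) - x * (w * w))
            ≈⟨ *-congˡ (+-congʳ (*-cong 1-sw 1-sw)) ⟩
          (s * s - x) * ((b * w) * (b * w) - x * (w * w))
            ≈⟨ *-congˡ (solve 3 (λ b w x → (b :* w) :* (b :* w) :- x :* (w :* w) := (b :* b :- x) :* (w :* w)) refl b w x) ⟩
          (s * s - x) * ((b * b - x) * (w * w)) ∎
          where
          1-sw : 1# - s * w ≈ b * w
          1-sw = begin
            1# - s * w              ≈⟨ +-congʳ sw+bw≈1 ⟨
            s * w + b * w - s * w   ≈⟨ solve 2 (λ x y → x :+ y :- x := y) refl (s * w) (b * w) ⟩
            b * w                   ∎

        0<[b²-x]w² : 0# < (b * b - x) * (w * w)
        0<[b²-x]w² = *-pos 0<b²-x (*-pos 0<w 0<w)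

        q-above : s * s < x → s < q
        q-above s²<x = 0<y-x⇒x<y (<-cong refl
          (solve 2 (λ s d → d := s :+ d :- s) refl s ((x - s * s) * w))
          (*-pos (x<y⇒0<y-x s²<x) 0<w))

        q²<x : s * s < x → q * q < x
        q²<x s²<x = 0<y-x⇒x<y (<-cong refl (begin
          (x - s * s) * ((b * b - x) * (w * w))
            ≈⟨ solve 3 (λ x y z → (x :- y) :* z := :- ((y :- x) :* z)) refl x (s * s) _ ⟩
          - ((s * s - x) * ((b * b - x) * (w * w)))
            ≈⟨ -‿cong q²-x ⟨
          - (q * q - x)
            ≈⟨ solve 2 (λ x y → :- (y :- x) := x :- y) refl x (q * q) ⟩
          x - q * q ∎)
          (*-pos (x<y⇒0<y-x s²<x) 0<[b²-x]w²))

        q-below : x < s * s → q < s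
        q-below x<s² = 0<y-x⇒x<y (<-cong refl
          (solve 3 (λ x s w → (s :* s :- x) :* w := s :- (s :+ (x :- s :* s) :* w)) refl x s w)
          (*-pos (x<y⇒0<y-x x<s²) 0<w))

        x<q² : x < s * s → x < q * q
        x<q² x<s² = 0<y-x⇒x<y (<-cong refl (sym q²-x) (*-pos (x<y⇒0<y-x x<s²) 0<[b²-x]w²))

        -- In closed form q = (sb + x)/(s + b). The sign matters because squaring is monotone only
        -- from a nonnegative smaller argument.
        0<q : 0# < s → 0# < q
        0<q 0<s = <-cong refl (begin
          (s * b + x) * w
            ≈⟨ solve 4 (λ x s b w → (s :* b :+ x) :* w := s :* (s :* w :+ b :* w) :+ (x :- s :* s) :* w)
                 refl x s b w ⟩
          s * (s * w + b * w) + (x - s * s) * w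
            ≈⟨ +-congʳ (trans (*-congˡ sw+bw≈1) (*-identityʳ s)) ⟩
          q ∎)
          (*-pos (+-pos (*-pos 0<s (+-pos 0<1 0<x)) 0<x) 0<w)

    √-exists : ∃[ s ] 0# < s × s * s ≈ x
    √-exists with complete Below (λ y≈z y²<x → <-cong (*-cong y≈z y≈z) refl y²<x)
                    (0# , 0-below) (b , b-upper)
    ... | s , upper , least with compare (s * s) x
    ...   | tri≈ _ s²≈x _ = s , 0≤x∧0<x*x⇒0<x (upper 0# 0-below) (<-cong refl (sym s²≈x) 0<x) , s²≈x
    ...   | tri< s²<x _ _ = contradiction (q-above s²<x) (upper q (q²<x s²<x))
      where open Dedekind (upper 0# 0-below)
    ...   | tri> _ _ x<s² = contradiction (q-below x<s²) (least q q-upper)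
      where
      open Dedekind (upper 0# 0-below)
      0<s : 0# < s
      0<s = 0≤x∧0<x*x⇒0<x (upper 0# 0-below) (<-trans 0<x x<s²)
      q-upper : IsUpperBound Below q
      q-upper y y²<x q<y = irrefl refl (<-trans (x<q² x<s²)
        (<-trans (*-mono-square-< (<⇒≤ (0<q 0<s)) q<y) y²<x))

  0<fromℕ : ∀ n → 0# < fromℕ (suc n)
  0<fromℕ zero    = <-cong refl (solve 0 (con (+ 1) := con (+ 1) :+ con (+ 0)) refl) 0<1
  0<fromℕ (suc n) = +-pos 0<1 (0<fromℕ n)

  fromℕ-mono-< : ∀ {m n} → m ℕ.< n → fromℕ m < fromℕ n
  fromℕ-mono-< {m} m<n with o , ≡.refl ← ℕ.m≤n⇒∃[o]m+o≡n m<n =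
    0<y-x⇒x<y (<-cong refl (begin
      1# + fromℕ o                       ≈⟨ solve 2 (λ m o → con (+ 1) :+ o := con (+ 1) :+ (m :+ o) :- m)
                                              refl (fromℕ m) (fromℕ o) ⟩
      1# + (fromℕ m + fromℕ o) - fromℕ m ≈⟨ +-congʳ (+-congˡ (×-homo-+ 1# m o)) ⟨
      fromℕ (suc m ℕ.+ o) - fromℕ m      ∎) (0<fromℕ o))

  fromℕ-* : ∀ m n → fromℕ (m ℕ.* n) ≈ fromℕ m * fromℕ n
  fromℕ-* = ×1-homo-*

  -- From an eigenvalue multiplicity to the form of the constant c.

  module EigenvalueGap (c : Carrier) {n} (1<n : 1 ℕ.< n) where
    ν = fromℕ n
    four = (1# + 1#) * (1# + 1#)

    0<four : 0# < four
    0<four = *-pos (+-pos 0<1 0<1) (+-pos 0<1 0<1)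

    0<ν : 0# < ν
    0<ν = fromℕ-mono-< (ℕ.<⇒≤ 1<n)

    0<ν-1 : 0# < ν - 1#
    0<ν-1 = x<y⇒0<y-x (<-cong (solve 0 (con (+ 1) :+ con (+ 0) := con (+ 1)) refl) refl (fromℕ-mono-< 1<n))

    νν⁻¹≈1 : ν * ν ⁻¹ ≈ 1#
    νν⁻¹≈1 = ⁻¹-inverseʳ ν (0<x⇒x≉0 0<ν)

    0<e² : 0# < c * c + four * (ν - 1#)
    0<e² = +-nonneg-pos (0≤x*x c) (*-pos 0<four 0<ν-1)

    -- Later steps rely on nothing but the sign and the square of `e`, so the supremum behind it
    -- stays opaque.
    abstract
      e : Carrier
      e = proj₁ (√-exists 0<e²)

      0<e : 0# < e
      0<e = proj₁ (proj₂ (√-exists 0<e²))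

      e²≈ : e * e ≈ c * c + four * (ν - 1#)
      e²≈ = proj₂ (proj₂ (√-exists 0<e²))

    -- The projection is αB + βI with α = 1/e and β = (e - c)/(2e). For B with zero diagonal, β is
    -- each diagonal entry of the projection, which makes νβ its trace.
    2e h α β : Carrier
    2e = (1# + 1#) * e
    h  = 2e ⁻¹
    α  = (1# + 1#) * h
    β  = h * (e - c)

    2eh≈1 : 2e * h ≈ 1#
    2eh≈1 = ⁻¹-inverseʳ 2e (0<x⇒x≉0 (*-pos (+-pos 0<1 0<1) 0<e))

    linear : α * c + (β + β) ≈ 1#
    linear = projection-linear c e h 2eh≈1

    quadratic : α * α * (ν - 1#) + β * β ≈ β
    quadratic = projection-quadratic c e h 2eh≈1 (ν - 1#) e²≈

    -- The witness is s = e/ν, and c = (ν - 2δ)s is cν = e(ν - 2δ) divided by ν. Nonvanishing of D =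
    -- δ(ν - δ) excludes both d = 0 and d = n, and also permits the division in s² = (ν - 1)/D.
    signatureConstant : ∀ d → d ℕ.≤ n → ν * β ≈ fromℕ d →
      1 ℕ.≤ d × d ℕ.< n × ComplexMatrices.IsSignatureConstant ℝ c n d
    signatureConstant d d≤n νβ≈δ = 1≤d d D≉0 , d<n , s , (0≤s , s²≈) , sym (begin
      (ν - fromℕ 2 * δ) * s   ≈⟨ solve 3 (λ x e w → x :* (e :* w) := (e :* x) :* w) refl _ e (ν ⁻¹) ⟩
      e * (ν - fromℕ 2 * δ) * ν ⁻¹  ≈⟨ *-congʳ cν≈ ⟨
      c * ν * ν ⁻¹            ≈⟨ solve 3 (λ c n w → c :* n :* w := c :* (n :* w)) refl c ν (ν ⁻¹) ⟩
      c * (ν * ν ⁻¹)          ≈⟨ *-congˡ νν⁻¹≈1 ⟩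
      c * 1#                  ≈⟨ *-identityʳ c ⟩
      c                       ∎)
      where
      δ = fromℕ d
      s = e * ν ⁻¹
      D = δ * (ν - δ)

      0≤s : 0# ≤ s
      0≤s = <⇒≤ (*-pos 0<e (⁻¹-pos 0<ν))

      cν≈ : c * ν ≈ e * (ν - fromℕ 2 * δ)
      cν≈ = gap-multiplicity c e h 2eh≈1 ν δ νβ≈δ

      -- Since e² - c² = 4(ν - 1) and cν = e(ν - 2δ), one gets 4(ν - 1)ν² = e²(ν² - (ν - 2δ)²) =
      -- 4De².
      [ν-1]ν²≈ : (ν - 1#) * (ν * ν) ≈ D * (e * e)
      [ν-1]ν²≈ = *-cancelˡ (0<x⇒x≉0 0<four) (gap-product c e (ν - 1#) ν δ e²≈ cν≈)

      D≉0 : ¬ D ≈ 0#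
      D≉0 D≈0 = irrefl (sym (trans [ν-1]ν²≈ (trans (*-congʳ D≈0) (zeroˡ _))))
                  (*-pos 0<ν-1 (*-pos 0<ν 0<ν))

      1≤d : ∀ d → ¬ fromℕ d * (ν - fromℕ d) ≈ 0# → 1 ℕ.≤ d
      1≤d zero    D≉0 = contradiction (zeroˡ _) D≉0
      1≤d (suc d) _   = s≤s z≤n

      d<n : d ℕ.< n
      d<n with ℕ.m≤n⇒m<n∨m≡n d≤n
      ... | inj₁ d<n = d<n
      ... | inj₂ ≡.refl = contradiction (solve 1 (λ x → x :* (x :- x) := con (+ 0)) refl ν) D≉0

      s²≈ : s * s ≈ (ν - 1#) / D
      s²≈ = *-cancelˡ D≉0 (begin
        D * (s * s)
          ≈⟨ solve 3 (λ D e w → D :* ((e :* w) :* (e :* w)) := D :* (e :* e) :* (w :* w)) refl D e (ν ⁻¹) ⟩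
        D * (e * e) * (ν ⁻¹ * ν ⁻¹)
          ≈⟨ *-congʳ [ν-1]ν²≈ ⟨
        (ν - 1#) * (ν * ν) * (ν ⁻¹ * ν ⁻¹)
          ≈⟨ solve 3 (λ x n w → x :* (n :* n) :* (w :* w) := x :* ((n :* w) :* (n :* w))) refl (ν - 1#) ν (ν ⁻¹) ⟩
        (ν - 1#) * (ν * ν ⁻¹ * (ν * ν ⁻¹))
          ≈⟨ *-congˡ (trans (*-cong νν⁻¹≈1 νν⁻¹≈1) (trans (*-identityʳ 1#) (sym (⁻¹-inverseʳ D D≉0)))) ⟩
        (ν - 1#) * (D * D ⁻¹)
          ≈⟨ solve 3 (λ x D v → x :* (D :* v) := D :* (x :* v)) refl (ν - 1#) D (D ⁻¹) ⟩
        D * ((ν - 1#) / D) ∎)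

-- Matrix algebra and Kronecker products.

quotient-remainder-injective : ∀ {m} n {i j : Fin (m ℕ.* n)} →
  quotient {m} n i ≡ quotient {m} n j → remainder {m} n i ≡ remainder {m} n j → i ≡ j
quotient-remainder-injective {m} n {i} {j} p≡ q≡ = ≡.trans (≡.sym (Fin.combine-remQuot {m} n i))
  (≡.trans (≡.cong₂ combine p≡ q≡) (Fin.combine-remQuot {m} n j))

module MatrixAlgebra {a ℓ} (R : CommutativeRing a ℓ)
  (≈0? : Decidable (λ x → CommutativeRing._≈_ R x (CommutativeRing.0# R)))
  (invert : ∀ x → ¬ CommutativeRing._≈_ R x (CommutativeRing.0# R) →
            ∃ λ y → CommutativeRing._≈_ R (CommutativeRing._*_ R x y) (CommutativeRing.1# R))
  where
  open CommutativeRing R hiding (zero)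
  open Algebra.Properties.CommutativeSemigroup *-commutativeSemigroup using (interchange)
  open Algebra.Properties.Semiring.Sum semiring
  open Algebra.Properties.Semiring.Mult semiring using (×-assoc-*) renaming (_×_ to _×#_)
  open CommutativeRingSums R
  open RingIdentities R
  open IdempotentTrace R ≈0? invert
  open Relation.Binary.Reasoning.Setoid setoid

  -- For R = ℂ the following operations are definitionally those of ComplexMatrices.
  infix  4 _≈ᴹ_
  infixl 7 _*ᴹ_ _⊗_

  Matrix : ℕ → ℕ → Set a
  Matrix m n = Fin m → Fin n → Carrier

  _≈ᴹ_ : ∀ {m n} → Matrix m n → Matrix m n → Set ℓ
  A ≈ᴹ B = ∀ i j → A i j ≈ B i j

  _*ᴹ_ : ∀ {m n p} → Matrix m n → Matrix n p → Matrix m p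
  (A *ᴹ B) i j = sum (λ k → A i k * B k j)

  I : ∀ n → Matrix n n
  I n i j = if does (i Fin.≟ j) then 1# else 0#

  _⊗_ : ∀ {m n p q} → Matrix m n → Matrix p q → Matrix (m ℕ.* p) (n ℕ.* q)
  _⊗_ {m} {n} {p} {q} A B i j =
    A (quotient {m} p i) (quotient {n} q j) * B (remainder {m} p i) (remainder {n} q j)

  I-≡ : ∀ {n} {i j : Fin n} → i ≡ j → I n i j ≡ 1#
  I-≡ {i = i} {j} i≡j with i Fin.≟ j
  ... | yes _   = ≡.refl
  ... | no  i≢j = contradiction i≡j i≢j

  I-≢ : ∀ {n} {i j : Fin n} → i ≢ j → I n i j ≡ 0#
  I-≢ {i = i} {j} i≢j with i Fin.≟ j
  ... | yes i≡j = contradiction i≡j i≢j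
  ... | no  _   = ≡.refl

  I-symmetric : ∀ {n} (i j : Fin n) → I n i j ≡ I n j i
  I-symmetric i j with i Fin.≟ j
  ... | yes i≡j = ≡.sym (I-≡ (≡.sym i≡j))
  ... | no  i≢j = ≡.sym (I-≢ (i≢j ∘ ≡.sym))

  I-⊗ : ∀ m n → I (m ℕ.* n) ≈ᴹ I m ⊗ I n
  I-⊗ m n i j with quotient {m} n i Fin.≟ quotient {m} n j | remainder {m} n i Fin.≟ remainder {m} n j
  ... | yes p≡ | yes q≡ = trans (reflexive (I-≡ (quotient-remainder-injective {m} n p≡ q≡)))
                              (sym (*-identityˡ 1#))
  ... | yes _  | no q≢  = trans (reflexive (I-≢ (q≢ ∘ ≡.cong (remainder {m} n)))) (sym (zeroʳ _))
  ... | no p≢  | _      = trans (reflexive (I-≢ (p≢ ∘ ≡.cong (quotient {m} n)))) (sym (zeroˡ _))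

  *ᴹ-identityˡ : ∀ {m n} (A : Matrix m n) → I m *ᴹ A ≈ᴹ A
  *ᴹ-identityˡ A i j = ∑-I i (λ k → A k j)
    where
    ∑-I : ∀ {n} i (f : Fin n → Carrier) → ∑[ k < n ] (I n i k * f k) ≈ f i
    ∑-I {suc n} zero f = begin
      1# * f zero + ∑[ k < n ] (0# * f (suc k))  ≈⟨ +-cong (*-identityˡ _) (sym (*-distribˡ-sum 0# (f ∘ suc))) ⟩
      f zero + 0# * ∑[ k < n ] f (suc k)         ≈⟨ +-congˡ (zeroˡ _) ⟩
      f zero + 0#                                ≈⟨ +-identityʳ _ ⟩
      f zero                                     ∎
    ∑-I (suc i) f = trans (+-cong (zeroˡ _) (∑-I i (f ∘ suc))) (+-identityˡ _)

  *ᴹ-identityʳ : ∀ {m n} (A : Matrix m n) → A *ᴹ I n ≈ᴹ A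
  *ᴹ-identityʳ {n = n} A i j = begin
    ∑[ k < n ] (A i k * I n k j)  ≈⟨ sum-cong-≋ (λ k → trans (*-comm _ _) (*-congʳ (reflexive (I-symmetric k j)))) ⟩
    ∑[ k < n ] (I n j k * A i k)  ≈⟨ *ᴹ-identityˡ (λ k _ → A i k) j j ⟩
    A i j                         ∎

  -- Every summand regroups into a factor in the quotient and a factor in the remainder of the inner
  -- index, so the sum factors.
  ⊗-*ᴹ : ∀ {m n m′ n′ m″ n″} (A : Matrix m m′) (B : Matrix n n′) (C : Matrix m′ m″) (D : Matrix n′ n″) →
         (A ⊗ B) *ᴹ (C ⊗ D) ≈ᴹ (A *ᴹ C) ⊗ (B *ᴹ D)
  ⊗-*ᴹ {m} {n} {m′} {n′} {m″} {n″} A B C D i j = trans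
    (sum-cong-≋ {m′ ℕ.* n′} (λ k → interchange _ _ _ _))
    (∑-quotient-remainder m′ n′
      (λ k → A (quotient {m} n i) k * C k (quotient {m″} n″ j))
      (λ k → B (remainder {m} n i) k * D k (remainder {m″} n″ j)))

  module _ {m n} (S : Matrix m m) (X Y : Matrix n n) (i j : Fin (m ℕ.* n)) where
    private
      p  = quotient {m} n i
      p′ = quotient {m} n j
      q  = remainder {m} n i
      q′ = remainder {m} n j

    -- B is a block matrix with copies of Y on the diagonal and multiples of X by entries of S
    -- elsewhere; its diagonal and the moduli of its entries are read off block by block.
    within-block : p ≡ p′ → S p p ≈ 0# → (S ⊗ X) i j + (I m ⊗ Y) i j ≈ Y q q′
    within-block p≡p′ S≈0 = begin
      S p p′ * X q q′ + I m p p′ * Y q q′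
        ≈⟨ +-cong (*-congʳ (trans (reflexive (≡.cong (S p) (≡.sym p≡p′))) S≈0))
                  (*-congʳ (reflexive (I-≡ p≡p′))) ⟩
      0# * X q q′ + 1# * Y q q′
        ≈⟨ trans (+-cong (zeroˡ _) (*-identityˡ _)) (+-identityˡ _) ⟩
      Y q q′ ∎

    across-blocks : p ≢ p′ → (S ⊗ X) i j + (I m ⊗ Y) i j ≈ S p p′ * X q q′
    across-blocks p≢p′ = begin
      S p p′ * X q q′ + I m p p′ * Y q q′
        ≈⟨ +-congˡ (trans (*-congʳ (reflexive (I-≢ p≢p′))) (zeroˡ _)) ⟩
      S p p′ * X q q′ + 0#
        ≈⟨ +-identityʳ _ ⟩
      S p p′ * X q q′ ∎

  -- The purely ring-theoretic part: the orders appear as free scalars `μ` and `ν`, and the Hadamard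
  -- condition in the form X² = νI. After the mixed-product rule, each entry is an instance of
  -- `signature-block`.
  amicable-square : ∀ {m n} (μ ν c k : Carrier) (S : Matrix m m) (X Y : Matrix n n) →
    (∀ i j → (S *ᴹ S) i j ≈ k * S i j + (μ - 1#) * I m i j) →
    (∀ i j → (X *ᴹ X) i j ≈ ν * I n i j) →
    (∀ i j → (Y *ᴹ Y) i j ≈ c * Y i j + (ν - 1#) * I n i j) →
    (∀ i j → c * X i j ≈ k * ν * I n i j + (X *ᴹ Y) i j + (Y *ᴹ X) i j) →
    let B : Matrix (m ℕ.* n) (m ℕ.* n)
        B i j = (S ⊗ X) i j + (I m ⊗ Y) i j
    in ∀ i j → (B *ᴹ B) i j ≈ c * B i j + (μ * ν - 1#) * I (m ℕ.* n) i j
  amicable-square {m} {n} μ ν c k S X Y S² X² Y² cX≈ i j = begin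
    ∑[ l < m ℕ.* n ] (((S ⊗ X) i l + (I m ⊗ Y) i l) * ((S ⊗ X) l j + (I m ⊗ Y) l j))
      ≈⟨ ∑-distrib-* ((S ⊗ X) i) ((I m ⊗ Y) i) (λ l → (S ⊗ X) l j) (λ l → (I m ⊗ Y) l j) ⟩
    ((S ⊗ X) *ᴹ (S ⊗ X)) i j + ((S ⊗ X) *ᴹ (I m ⊗ Y)) i j +
    ((I m ⊗ Y) *ᴹ (S ⊗ X)) i j + ((I m ⊗ Y) *ᴹ (I m ⊗ Y)) i j
      ≈⟨ +-cong (+-cong (+-cong (⊗-*ᴹ S X S X i j) (⊗-*ᴹ S X (I m) Y i j))
                        (⊗-*ᴹ (I m) Y S X i j)) (⊗-*ᴹ (I m) Y (I m) Y i j) ⟩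
    (S *ᴹ S) p p′ * (X *ᴹ X) q q′ + (S *ᴹ I m) p p′ * (X *ᴹ Y) q q′ +
    (I m *ᴹ S) p p′ * (Y *ᴹ X) q q′ + (I m *ᴹ I m) p p′ * (Y *ᴹ Y) q q′
      ≈⟨ +-cong (+-cong (+-cong (*-cong (S² p p′) (X² q q′)) (*-congʳ (*ᴹ-identityʳ S p p′)))
                        (*-congʳ (*ᴹ-identityˡ S p p′))) (*-cong (*ᴹ-identityˡ (I m) p p′) (Y² q q′)) ⟩
    _ ≈⟨ signature-block c k μ ν (S p p′) (X q q′) (Y q q′) (I m p p′) (I n q q′) _ _ (cX≈ q q′) ⟩
    _ ≈⟨ +-congˡ (*-congˡ (I-⊗ m n i j)) ⟨
    c * ((S ⊗ X) i j + (I m ⊗ Y) i j) + (μ * ν - 1#) * I (m ℕ.* n) i j ∎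
    where
    p  = quotient {m} n i
    p′ = quotient {m} n j
    q  = remainder {m} n i
    q′ = remainder {m} n j

  module _ {n} (c μ α β : Carrier) (B : Matrix n n)
           (B² : ∀ i j → (B *ᴹ B) i j ≈ c * B i j + μ * I n i j)
           (linear : α * c + (β + β) ≈ 1#) (quadratic : α * α * μ + β * β ≈ β) where
    private
      P : Matrix n n
      P i j = α * B i j + β * I n i j

      P²≈P : IsIdempotent P
      P²≈P i j = begin
        ∑[ k < n ] (P i k * P k j)
          ≈⟨ ∑-bilinear α β α β (B i) (I n i) (λ k → B k j) (λ k → I n k j) ⟩
        α * α * (B *ᴹ B) i j + α * β * (B *ᴹ I n) i j + β * α * (I n *ᴹ B) i j + β * β * (I n *ᴹ I n) i j
          ≈⟨ +-cong (+-cong (+-cong (*-congˡ (B² i j)) (*-congˡ (*ᴹ-identityʳ B i j)))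
                            (*-congˡ (*ᴹ-identityˡ B i j))) (*-congˡ (*ᴹ-identityˡ (I n) i j)) ⟩
        _ ≈⟨ idempotent-coefficients c μ α β (B i j) (I n i j) linear quadratic ⟩
        P i j ∎

    -- The zero diagonal reduces the trace of the idempotent αB + βI to nβ, which integrality then
    -- forces to be a natural number.
    multiplicity : (∀ i → B i i ≈ 0#) → ∃[ d ] d ℕ.≤ n × n ×# 1# * β ≈ d ×# 1#
    multiplicity B-diagonal =
      let d , d≤n , tr≈d = idempotent-trace P P²≈P
      in d , d≤n , trans (sym trace-P) tr≈d
      where
      trace-P : trace P ≈ n ×# 1# * β
      trace-P = begin
        ∑[ k < n ] (α * B k k + β * I n k k)
          ≈⟨ sum-cong-≋ (λ k → trans
               (+-cong (trans (*-congˡ (B-diagonal k)) (zeroʳ α))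
                       (trans (*-congˡ (reflexive (I-≡ {i = k} ≡.refl))) (*-comm β 1#)))
               (+-identityˡ (1# * β))) ⟩
        ∑[ k < n ] (1# * β)
          ≈⟨ sum-replicate n ⟩
        n ×# (1# * β)
          ≈⟨ ×-assoc-* n 1# β ⟨
        n ×# 1# * β ∎

-- The field of complex numbers, conjugation and modulus.

module ComplexNumbers {a ℓ} (ℝ : CompleteOrderedField a ℓ) where
  open ComplexMatrices ℝ
  private
    module ℝ where
      open CompleteOrderedField ℝ public
      open OrderedFieldProperties ℝ public
      open CommutativeRing commutativeRing public
        using (refl; sym; trans; setoid; +-cong; *-cong; -‿cong; +-identityʳ; *-identityʳ)
  open IntegerCoefficientSolver ℝ.commutativeRing

  ℂ-commutativeRing : CommutativeRing a ℓ
  ℂ-commutativeRing = record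
    { RawRing ℂ-rawRing
    ; isCommutativeRing = record
      { isRing = record
        { +-isAbelianGroup = record
          { isGroup = record
            { isMonoid = record
              { isSemigroup = record
                { isMagma = record
                  { isEquivalence = record
                    { refl  = ℝ.refl , ℝ.refl
                    ; sym   = λ (p , q) → ℝ.sym p , ℝ.sym q
                    ; trans = λ (p , q) (r , s) → ℝ.trans p r , ℝ.trans q s }
                  ; ∙-cong = λ (p , q) (r , s) → ℝ.+-cong p r , ℝ.+-cong q s }
                ; assoc = λ x y z → +-assoc (re x) (re y) (re z) , +-assoc (im x) (im y) (im z) }
              ; identity = (λ x → +-identityˡ (re x) , +-identityˡ (im x))
                         , (λ x → ℝ.+-identityʳ (re x) , ℝ.+-identityʳ (im x)) }
            ; inverse = (λ x → +-inverseˡ (re x) , +-inverseˡ (im x))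
                      , (λ x → +-inverseʳ (re x) , +-inverseʳ (im x))
            ; ⁻¹-cong = λ (p , q) → ℝ.-‿cong p , ℝ.-‿cong q }
          ; comm = λ x y → +-comm (re x) (re y) , +-comm (im x) (im y) }
        ; *-cong = λ (p , q) (r , s) →
            ℝ.+-cong (ℝ.*-cong p r) (ℝ.-‿cong (ℝ.*-cong q s)) , ℝ.+-cong (ℝ.*-cong p s) (ℝ.*-cong q r)
        ; *-assoc = λ (a +i b) (c +i d) (e +i f) →
            solve 6 (λ a b c d e f → (a :* c :- b :* d) :* e :- (a :* d :+ b :* c) :* f :=
                                     a :* (c :* e :- d :* f) :- b :* (c :* f :+ d :* e)) ℝ.refl a b c d e f ,
            solve 6 (λ a b c d e f → (a :* c :- b :* d) :* f :+ (a :* d :+ b :* c) :* e :=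
                                     a :* (c :* f :+ d :* e) :+ b :* (c :* e :- d :* f)) ℝ.refl a b c d e f
        ; *-identity =
            (λ (a +i b) → solve 2 (λ a b → con (+ 1) :* a :- con (+ 0) :* b := a) ℝ.refl a b
                        , solve 2 (λ a b → con (+ 1) :* b :+ con (+ 0) :* a := b) ℝ.refl a b) ,
            (λ (a +i b) → solve 2 (λ a b → a :* con (+ 1) :- b :* con (+ 0) := a) ℝ.refl a b
                        , solve 2 (λ a b → a :* con (+ 0) :+ b :* con (+ 1) := b) ℝ.refl a b)
        ; distrib =
            (λ (a +i b) (c +i d) (e +i f) →
               solve 6 (λ a b c d e f → a :* (c :+ e) :- b :* (d :+ f) :=
                                        (a :* c :- b :* d) :+ (a :* e :- b :* f)) ℝ.refl a b c d e f ,
               solve 6 (λ a b c d e f → a :* (d :+ f) :+ b :* (c :+ e) :=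
                                        (a :* d :+ b :* c) :+ (a :* f :+ b :* e)) ℝ.refl a b c d e f) ,
            (λ (a +i b) (c +i d) (e +i f) →
               solve 6 (λ a b c d e f → (c :+ e) :* a :- (d :+ f) :* b :=
                                        (c :* a :- d :* b) :+ (e :* a :- f :* b)) ℝ.refl a b c d e f ,
               solve 6 (λ a b c d e f → (c :+ e) :* b :+ (d :+ f) :* a :=
                                        (c :* b :+ d :* a) :+ (e :* b :+ f :* a)) ℝ.refl a b c d e f) }
      ; *-comm = λ (a +i b) (c +i d) →
          solve 4 (λ a b c d → a :* c :- b :* d := c :* a :- d :* b) ℝ.refl a b c d ,
          solve 4 (λ a b c d → a :* d :+ b :* c := c :* b :+ d :* a) ℝ.refl a b c d } }
    where open CommutativeRing ℝ.commutativeRing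
            using (+-assoc; +-comm; +-identityˡ)
            renaming (-‿inverseˡ to +-inverseˡ; -‿inverseʳ to +-inverseʳ)

  open CommutativeRing ℂ-commutativeRing using (_≈_; _+_; _*_; _-_; 0#; 1#; refl; trans; +-cong; semiring)
  open Algebra.Properties.Semiring.Mult semiring using () renaming (_×_ to _×#_)

  -- Trichotomy of the real order decides both components; the search for pivots depends on it.
  ≈0? : Decidable (_≈ 0#)
  ≈0? (x +i y) with x ℝ.≟ ℝ.0# | y ℝ.≟ ℝ.0#
  ... | yes x≈0 | yes y≈0 = yes (x≈0 , y≈0)
  ... | no  x≉0 | _       = no (x≉0 ∘ proj₁)
  ... | yes _   | no  y≉0 = no (y≉0 ∘ proj₂)

  -- The inverse is the conjugate over the squared modulus, and in an ordered field a sum of two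
  -- squares vanishes only if both terms do.
  invert : ∀ z → ¬ z ≈ 0# → ∃ λ w → z * w ≈ 1#
  invert (x +i y) z≉0 = ((x ℝ.* w) +i (ℝ.- (y ℝ.* w))) ,
    ℝ.trans (solve 3 (λ x y w → x :* (x :* w) :- y :* :- (y :* w) := (x :* x :+ y :* y) :* w)
               ℝ.refl x y w)
            (ℝ.⁻¹-inverseʳ (x ℝ.* x ℝ.+ y ℝ.* y) λ |z|²≈0 → z≉0
              ( ℝ.x*x+y*y≈0⇒y≈0 y x (ℝ.trans (solve 2 (λ x y → y :* y :+ x :* x := x :* x :+ y :* y) ℝ.refl x y) |z|²≈0)
              , ℝ.x*x+y*y≈0⇒y≈0 x y |z|²≈0)) ,
    solve 3 (λ x y w → x :* :- (y :* w) :+ y :* (x :* w) := con (+ 0)) ℝ.refl x y w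
    where w = (x ℝ.* x ℝ.+ y ℝ.* y) ℝ.⁻¹

  ofReal-cong : ∀ {x y} → x ℝ.≈ y → ofReal x ≈ ofReal y
  ofReal-cong x≈y = x≈y , ℝ.refl

  ofReal-+ : ∀ x y → ofReal (x ℝ.+ y) ≈ ofReal x + ofReal y
  ofReal-+ x y = ℝ.refl , ℝ.sym (ℝ.+-identityʳ ℝ.0#)

  ofReal-- : ∀ x y → ofReal (x ℝ.- y) ≈ ofReal x - ofReal y
  ofReal-- x y = ℝ.refl , solve 0 (con (+ 0) := con (+ 0) :- con (+ 0)) ℝ.refl

  ofReal-* : ∀ x y → ofReal (x ℝ.* y) ≈ ofReal x * ofReal y
  ofReal-* x y =
    solve 2 (λ x y → x :* y := x :* y :- con (+ 0) :* con (+ 0)) ℝ.refl x y ,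
    solve 2 (λ x y → con (+ 0) := x :* con (+ 0) :+ con (+ 0) :* y) ℝ.refl x y

  ofReal-fromℕ : ∀ n → ofReal (ℝ.fromℕ n) ≈ n ×# 1#
  ofReal-fromℕ zero    = refl
  ofReal-fromℕ (suc n) = trans (ofReal-+ ℝ.1# (ℝ.fromℕ n)) (+-cong refl (ofReal-fromℕ n))

  conj-cong : ∀ {z w} → z ≈ w → conj z ≈ conj w
  conj-cong (p , q) = p , ℝ.-‿cong q

  conj-0 : conj 0# ≈ 0#
  conj-0 = ℝ.refl , solve 0 (:- con (+ 0) := con (+ 0)) ℝ.refl

  conj-1 : conj 1# ≈ 1#
  conj-1 = ℝ.refl , solve 0 (:- con (+ 0) := con (+ 0)) ℝ.refl

  conj-+ : ∀ z w → conj (z + w) ≈ conj z + conj w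
  conj-+ (a +i b) (c +i d) = ℝ.refl , solve 2 (λ b d → :- (b :+ d) := :- b :+ :- d) ℝ.refl b d

  conj-* : ∀ z w → conj (z * w) ≈ conj z * conj w
  conj-* (a +i b) (c +i d) =
    solve 4 (λ a b c d → a :* c :- b :* d := a :* c :- :- b :* :- d) ℝ.refl a b c d ,
    solve 4 (λ a b c d → :- (a :* d :+ b :* c) := a :* :- d :+ :- b :* c) ℝ.refl a b c d

  modulus-cong : ∀ {r z w} → z ≈ w → r IsModulusOf z → r IsModulusOf w
  modulus-cong (p , q) (0≤r , eq) = 0≤r , ℝ.trans eq (ℝ.+-cong (ℝ.*-cong p p) (ℝ.*-cong q q))

  -- Multiplicativity of the squared modulus is the two-square identity. Modulus one is recorded as
  -- an equation for `1# * 1#`, hence the padding by factors of one.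
  unimodular-* : ∀ {z w} → ℝ.1# IsModulusOf z → ℝ.1# IsModulusOf w → ℝ.1# IsModulusOf (z * w)
  unimodular-* {a +i b} {c +i d} (0≤1 , |z|²≈1) (_ , |w|²≈1) = 0≤1 , (begin
    ℝ.1# ℝ.* ℝ.1#
      ≈⟨ ℝ.*-identityʳ _ ⟨
    ℝ.1# ℝ.* ℝ.1# ℝ.* ℝ.1#
      ≈⟨ ℝ.*-cong |z|²≈1 (ℝ.trans (ℝ.sym (ℝ.*-identityʳ _)) |w|²≈1) ⟩
    (a ℝ.* a ℝ.+ b ℝ.* b) ℝ.* (c ℝ.* c ℝ.+ d ℝ.* d)
      ≈⟨ solve 4 (λ a b c d → (a :* a :+ b :* b) :* (c :* c :+ d :* d) :=
           (a :* c :- b :* d) :* (a :* c :- b :* d) :+ (a :* d :+ b :* c) :* (a :* d :+ b :* c))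
           ℝ.refl a b c d ⟩
    (a ℝ.* c ℝ.- b ℝ.* d) ℝ.* (a ℝ.* c ℝ.- b ℝ.* d) ℝ.+ (a ℝ.* d ℝ.+ b ℝ.* c) ℝ.* (a ℝ.* d ℝ.+ b ℝ.* c) ∎)
    where open Relation.Binary.Reasoning.Setoid ℝ.setoid

-- The signature properties of B.

module AmicableSignature {a ℓ} (ℝ : CompleteOrderedField a ℓ) where
  open ComplexMatrices ℝ
  open ComplexNumbers ℝ
  open CommutativeRing ℂ-commutativeRing
    using (_≈_; _+_; _*_; _-_; 0#; 1#; sym; trans; reflexive; setoid; semiring;
           +-cong; +-congˡ; +-congʳ; *-cong; *-congˡ; *-congʳ)
  open Algebra.Properties.Semiring.Sum semiring using (sum-cong-≋)
  open Algebra.Properties.Semiring.Mult semiring using () renaming (_×_ to _×#_)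
  private
    module M = MatrixAlgebra ℂ-commutativeRing ≈0? invert
    module ℝ where
      open CompleteOrderedField ℝ public
      open OrderedFieldProperties ℝ public

  quadratic-entry : ∀ {c n} (A B : Matrix n n) →
    A ≈ᴹ c · B +ᴹ (ℝ.fromℕ n ℝ.- ℝ.1#) · I n →
    ∀ i j → A i j ≈ ofReal c * B i j + (ofReal (ℝ.fromℕ n) - 1#) * I n i j
  quadratic-entry {c} {n} A B A≈ i j = trans {A i j} (A≈ i j)
    (+-congˡ {ofReal c * B i j} (*-congʳ {I n i j} (ofReal-- (ℝ.fromℕ n) ℝ.1#)))

  amicable-square : ∀ {c k N M} (X Y : Matrix N N) (S : Matrix M M) →
    IsETFAmicable c k N X Y → IsSignature k M S →
    let B = S ⊗ X +ᴹ I M ⊗ Y in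
    B *ᴹ B ≈ᴹ c · B +ᴹ (ℝ.fromℕ (M ℕ.* N) ℝ.- ℝ.1#) · I (M ℕ.* N)
  amicable-square {c} {k} {N} {M} X Y S XY-amicable S-signature i j =
    trans {(B *ᴹ B) i j}
      (M.amicable-square μ ν (ofReal c) (ofReal k) S X Y
        (quadratic-entry (S *ᴹ S) S (IsSignature.quadratic S-signature))
        (λ i j → trans {(X *ᴹ X) i j}
           -- Hermitian symmetry replaces X by its adjoint in the second factor, so XX* = NI reads
           -- X² = NI.
           (sum-cong-≋ {N} {λ l → X i l * X l j} (λ l → *-congˡ {X i l} (X-hermitian l j)))
           (orthogonal i j))
        (quadratic-entry (Y *ᴹ Y) Y (IsSignature.quadratic Y-signature))
        (λ i j → trans {ofReal c * X i j} (amicable i j)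
           (+-congʳ {(Y *ᴹ X) i j} (+-congʳ {(X *ᴹ Y) i j} (*-congʳ {I N i j} (ofReal-* k (ℝ.fromℕ N))))))
        i j)
      (+-congˡ {ofReal c * B i j} (*-congʳ {I (M ℕ.* N) i j} (sym MN-1)))
    where
    open IsETFAmicable XY-amicable
    open IsHadamard X-hadamard
    B = S ⊗ X +ᴹ I M ⊗ Y
    μ = ofReal (ℝ.fromℕ M)
    ν = ofReal (ℝ.fromℕ N)
    MN-1 : ofReal (ℝ.fromℕ (M ℕ.* N) ℝ.- ℝ.1#) ≈ μ * ν - 1#
    MN-1 = trans (ofReal-- (ℝ.fromℕ (M ℕ.* N)) ℝ.1#)
             (+-congʳ (trans (ofReal-cong (ℝ.fromℕ-* M N)) (ofReal-* (ℝ.fromℕ M) (ℝ.fromℕ N))))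

  ofReal-linear : ∀ α β c → α ℝ.* c ℝ.+ (β ℝ.+ β) ℝ.≈ ℝ.1# →
    ofReal α * ofReal c + (ofReal β + ofReal β) ≈ 1#
  ofReal-linear α β c eq = begin
    ofReal α * ofReal c + (ofReal β + ofReal β)   ≈⟨ +-cong (ofReal-* α c) (ofReal-+ β β) ⟨
    ofReal (α ℝ.* c) + ofReal (β ℝ.+ β)           ≈⟨ ofReal-+ (α ℝ.* c) (β ℝ.+ β) ⟨
    ofReal (α ℝ.* c ℝ.+ (β ℝ.+ β))                ≈⟨ ofReal-cong eq ⟩
    1#                                            ∎
    where open Relation.Binary.Reasoning.Setoid setoid

  ofReal-quadratic : ∀ α β m → α ℝ.* α ℝ.* m ℝ.+ β ℝ.* β ℝ.≈ β →
    ofReal α * ofReal α * ofReal m + ofReal β * ofReal β ≈ ofReal β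
  ofReal-quadratic α β m eq = begin
    ofReal α * ofReal α * ofReal m + ofReal β * ofReal β
      ≈⟨ +-cong (*-congʳ {ofReal m} (ofReal-* α α)) (ofReal-* β β) ⟨
    ofReal (α ℝ.* α) * ofReal m + ofReal (β ℝ.* β)
      ≈⟨ +-congʳ {ofReal (β ℝ.* β)} (ofReal-* (α ℝ.* α) m) ⟨
    ofReal (α ℝ.* α ℝ.* m) + ofReal (β ℝ.* β)
      ≈⟨ ofReal-+ (α ℝ.* α ℝ.* m) (β ℝ.* β) ⟨
    ofReal (α ℝ.* α ℝ.* m ℝ.+ β ℝ.* β)
      ≈⟨ ofReal-cong eq ⟩
    ofReal β ∎
    where open Relation.Binary.Reasoning.Setoid setoid

  -- The trace is computed over ℂ; real parts carry its value back to the ordered field, where the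
  -- bounds on d are derived.
  ofReal-multiplicity : ∀ n d β → n ×# 1# * ofReal β ≈ d ×# 1# → ℝ.fromℕ n ℝ.* β ℝ.≈ ℝ.fromℕ d
  ofReal-multiplicity n d β nβ≈d = proj₁ (begin
    ofReal (ℝ.fromℕ n ℝ.* β)        ≈⟨ ofReal-* (ℝ.fromℕ n) β ⟩
    ofReal (ℝ.fromℕ n) * ofReal β   ≈⟨ *-congʳ {ofReal β} (ofReal-fromℕ n) ⟩
    n ×# 1# * ofReal β              ≈⟨ nβ≈d ⟩
    d ×# 1#                         ≈⟨ ofReal-fromℕ d ⟨
    ofReal (ℝ.fromℕ d)              ∎)
    where open Relation.Binary.Reasoning.Setoid setoid

  -- The quadratic equation makes the projection idempotent, and the zero diagonal makes its trace
  -- nβ. The bound 1 < n keeps e² = c² + 4(n - 1) positive even when c vanishes.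
  signatureConstant-exists : ∀ {c n} (B : Matrix n n) → 1 ℕ.< n → (∀ i → B i i ≈ 0#) →
    B *ᴹ B ≈ᴹ c · B +ᴹ (ℝ.fromℕ n ℝ.- ℝ.1#) · I n →
    ∃[ d ] 1 ℕ.≤ d × d ℕ.< n × IsSignatureConstant c n d
  signatureConstant-exists {c} {n} B 1<n B-diagonal B² =
    let d , d≤n , nβ≈d = M.multiplicity (ofReal c) (ofReal (ν ℝ.- ℝ.1#)) (ofReal α) (ofReal β) B B²
                           (ofReal-linear α β c linear) (ofReal-quadratic α β (ν ℝ.- ℝ.1#) quadratic)
                           B-diagonal
    in d , signatureConstant d d≤n (ofReal-multiplicity n d β nβ≈d)
    where open ℝ.EigenvalueGap c 1<n

  ⊗-hermitian : ∀ {m n} {A : Matrix m m} {B : Matrix n n} →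
                IsHermitian A → IsHermitian B → IsHermitian (A ⊗ B)
  ⊗-hermitian {m} {n} {A} {B} A-hermitian B-hermitian i j =
    trans {(A ⊗ B) i j} {conj z * conj w} (*-cong (A-hermitian p p′) (B-hermitian q q′)) (sym (conj-* z w))
    where
    p  = quotient {m} n i
    p′ = quotient {m} n j
    q  = remainder {m} n i
    q′ = remainder {m} n j
    z = A p′ p
    w = B q′ q

  +ᴹ-hermitian : ∀ {n} {A B : Matrix n n} → IsHermitian A → IsHermitian B → IsHermitian (A +ᴹ B)
  +ᴹ-hermitian {A = A} {B} A-hermitian B-hermitian i j =
    trans {A i j + B i j} {conj (A j i) + conj (B j i)}
      (+-cong (A-hermitian i j) (B-hermitian i j)) (sym (conj-+ (A j i) (B j i)))

  I-hermitian : ∀ {n} → IsHermitian (I n)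
  I-hermitian i j with i Fin.≟ j
  ... | yes i≡j = sym (trans (conj-cong (reflexive (M.I-≡ (≡.sym i≡j)))) conj-1)
  ... | no  i≢j = sym (trans (conj-cong (reflexive (M.I-≢ (i≢j ∘ ≡.sym)))) conj-0)

  amicable-signature : ∀ {c k N M} (X Y : Matrix N N) (S : Matrix M M) → 1 ℕ.< M ℕ.* N →
    IsETFAmicable c k N X Y → IsSignature k M S → IsSignature c (M ℕ.* N) (S ⊗ X +ᴹ I M ⊗ Y)
  amicable-signature {c} {k} {N} {M} X Y S 1<MN XY-amicable S-signature = record
    { hermitian   = +ᴹ-hermitian {A = S ⊗ X} {I M ⊗ Y}
                      (⊗-hermitian {A = S} {X} S.hermitian X-hermitian)
                      (⊗-hermitian {A = I M} {Y} I-hermitian Y.hermitian)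
    ; diagonal    = B-diagonal
    ; offDiagonal = B-offDiagonal
    ; quadratic   = B²
    ; constant    = signatureConstant-exists B 1<MN B-diagonal B²
    }
    where
    open IsETFAmicable XY-amicable
    module S = IsSignature S-signature
    module Y = IsSignature Y-signature
    B = S ⊗ X +ᴹ I M ⊗ Y
    B² = amicable-square X Y S XY-amicable S-signature

    B-diagonal : ∀ i → B i i ≈ 0#
    B-diagonal i = trans {B i i} {Y q q}
      (M.within-block S X Y i i ≡.refl (S.diagonal (quotient {M} N i))) (Y.diagonal q)
      where q = remainder {M} N i

    B-offDiagonal : ∀ i j → i ≢ j → ℝ.1# IsModulusOf B i j
    B-offDiagonal i j i≢j = split (p Fin.≟ p′)
      where
      p  = quotient {M} N i
      p′ = quotient {M} N j
      q  = remainder {M} N i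
      q′ = remainder {M} N j

      split : Dec (p ≡ p′) → ℝ.1# IsModulusOf B i j
      split (yes p≡p′) = modulus-cong {z = Y q q′} {B i j}
        (sym {B i j} (M.within-block S X Y i j p≡p′ (S.diagonal p)))
        -- Distinct indices within one block have distinct remainders, so the entry of Y lies off
        -- its diagonal.
        (Y.offDiagonal q q′ (i≢j ∘ quotient-remainder-injective {M} N p≡p′))
      split (no p≢p′) = modulus-cong {z = S p p′ * X q q′} {B i j}
        (sym {B i j} (M.across-blocks S X Y i j p≢p′))
        -- Across blocks the remainders may agree, but every entry of X is unimodular, including the
        -- diagonal ones.
        (unimodular-* {S p p′} {X q q′} (S.offDiagonal p p′ p≢p′) (IsHadamard.unimodular X-hadamard q q′))

open import Data.Nat.Base using (_≤_; _*_)

theorem1 : ∀ {a ℓ : Level} (ℝ : CompleteOrderedField a ℓ) →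
    let open CompleteOrderedField ℝ using (Carrier)
        open ComplexMatrices ℝ
    in
    ∀ (N M : ℕ) → 2 ≤ N → 2 ≤ M →
    ∀ (c k : Carrier) (X Y : Matrix N N) → IsETFAmicable c k N X Y →
    ∀ (S : Matrix M M) → IsSignature k M S →
    IsSignature c (M * N) (S ⊗ X +ᴹ I M ⊗ Y)
theorem1 ℝ N M 2≤N 2≤M c k X Y XY-amicable S S-signature =
  AmicableSignature.amicable-signature ℝ X Y S
    -- `2 ≤ M` is already 1 < M, and M ≤ MN because N is nonzero.
    (ℕ.≤-trans 2≤M (ℕ.m≤m*n M N ⦃ ℕ.>-nonZero (ℕ.<⇒≤ 2≤N) ⦄)) XY-amicable S-signature
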